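{- Let $n\ge1$, let $k\in\mathbb{Z}_{\ge0}$ and let $t=q^k$. Then $$(1,1)_{q,q^k}=\mathrm{ct}\left(\frac{1}{\Delta^X_\infty\Delta^X_0\Delta^{X^{ -1}}_\infty}\right)=\prod_{i=2}^n\binom{ik}{k}_q$$ and $$\frac1{W_0(q^k)}(1,1)_{q,q^k}=\mathrm{ct}\left(\frac{1}{\Delta^X_\infty\Delta^X_0\Delta^{X^{ -1}}_0\Delta^{X^{ -1}}_\infty}\right)=\prod_{h=2}^{n}\binom{hk-1}{k-1}_q.$$
   Context: $\binom{a}{b}_q=\frac{(q;q)_a}{(q;q)_b(q;q)_{a-b}}$ is the $q$-binomial coefficient, where $(z;q)_k=\prod_{r=0}^{k-1}(1-q^rz)$; $\mathrm{ct}(f)$ is the constant term of $f$ in the variables $x_1,\ldots,x_n$; $W_0(t)=\sum_{w\in S_n}t^{\ell(w)}$ with $\ell$ the length function of the symmetric group $S_n$. Put $$\Delta_\infty^X=\prod_{1\le i<j\le n}\prod_{r\ge1}\frac{1-tq^rx_ix_j^{ -1}}{1-q^rx_ix_j^{ -1}},\qquad \Delta_0^{X}=\prod_{1\le i<j\le n}\frac{1-tx_ix_j^{ -1}}{1-x_ix_j^{ -1}},$$ and let $\Delta_\infty^{X^{ -1}},\Delta_0^{X^{ -1}}$ be obtained from these by replacing each $x_i$ by $x_i^{ -1}$. For $t=q^k$ one has $\frac{1}{\Delta^X_\infty\Delta^X_0\Delta^{X^{ -1}}_\infty}=\prod_{i<j}(x_ix_j^{ -1};q)_k(qx_i^{ -1}x_j;q)_k$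 and $\frac1{\Delta^X_\infty\Delta^X_0\Delta^{X^{ -1}}_0\Delta^{X^{ -1}}_\infty}=\prod_{i<j}(x_ix_j^{ -1};q)_k(x_i^{ -1}x_j;q)_k$, which are Laurent polynomials. The inner product is $(f_1,f_2)_{q,t}=\mathrm{ct}\Big(\frac{f_1\overline{f_2}}{\Delta^X_\infty\Delta^X_0\Delta^{X^{ -1}}_\infty}\Big)$, where $\overline{f}(x_1,\ldots,x_n;q,t)=f(x_1^{ -1},\ldots,x_n^{ -1};q^{ -1},t^{ -1})$, and $(\,,)_{q,q^k}$ is its value at $t=q^k$.
   Formalization: In the second display the constant term is divided by n! (as printed it fails: for n=2, k=1 it is 2, the other members are 1), and the last equality is stated only for k≥1 or n=1, since for k=0, n≥2 the q-binomial with entries -1, -1 is undefined. -}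

module Defs where

open import Level using (Level; _⊔_; suc)
open import Algebra.Apartness.Bundles using (HeytingField)
import Algebra.Apartness.Properties.HeytingCommutativeRing as HeytingProperties
open import Algebra.Bundles using (RawRing; CommutativeRing)
import Algebra.Definitions.RawSemiring as RawSemiringDefinitions
open import Algebra.Morphism.Structures using (module RingMorphisms)
open import Data.Bool using (if_then_else_)
open import Data.Fin as Fin using (Fin)
import Data.Fin.Properties as Fin
open import Data.Fin.Permutation as Perm using (Permutation′; _⟨$⟩ʳ_)
open import Data.Integer as ℤ using (ℤ)
import Data.Integer.Properties as ℤ
open import Data.List as List using (List; []; _∷_; _++_)
open import Data.Nat as ℕ using (ℕ; NonZero; _∸_; _!)
open import Data.Nat.Properties using (_!≢0)
open import Data.Product using (_×_; _,_; proj₁)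
open import Data.Vec as Vec using (Vec)
import Data.Vec.Properties as Vec
open import Relation.Nullary.Decidable using (does)

private
  variable
    a c ℓ ℓ₁ ℓ₂ : Level

------------------------------------------------------------------------
-- Index ranges

pairs : ∀ n → List (Fin n × Fin n)
pairs n = List.cartesianProduct (List.allFin n) (List.allFin n)

-- { (i , j) ∣ i < j }
increasingPairs : ∀ n → List (Fin n × Fin n)
increasingPairs n = List.filter (λ (i , j) → i Fin.<? j) (pairs n)

-- 2 , 3 , … , n
[2⋯_] : ℕ → List ℕ
[2⋯ n ] = List.map (2 ℕ.+_) (List.upTo (n ∸ 1))

------------------------------------------------------------------------
-- The symmetric group

-- `insert zero j π` sends 0 to j and agrees with π, up to the order
-- preserving relabelling, on the remaining points.  Every permutation of
-- Fin (suc n) has this form for exactly one j and one π, so the list below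
-- contains each element of Sₙ exactly once.
permutations : ∀ n → List (Permutation′ n)
permutations ℕ.zero    = Perm.id ∷ []
permutations (ℕ.suc n) =
  List.cartesianProductWith (Perm.insert Fin.zero)
    (List.allFin (ℕ.suc n)) (permutations n)

-- The length function of Sₙ: the number of inversions i < j, π i > π j.
length : ∀ {n} → Permutation′ n → ℕ
length {n} π =
  List.length
    (List.filter (λ (i , j) → (π ⟨$⟩ʳ j) Fin.<? (π ⟨$⟩ʳ i)) (increasingPairs n))

------------------------------------------------------------------------
-- Products, q-Pochhammer symbols and the Poincaré polynomial in a ring

module RingOperations (R : RawRing c ℓ) where

  open RawRing R hiding (_≈_)
  open RawSemiringDefinitions rawSemiring using (_^_)

  ∏ : {A : Set a} → List A → (A → Carrier) → Carrier
  ∏ xs f = List.foldr _*_ 1# (List.map f xs)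

  ∑ : {A : Set a} → List A → (A → Carrier) → Carrier
  ∑ xs f = List.foldr _+_ 0# (List.map f xs)

  -- pochhammer q z k = (z;q)ₖ
  pochhammer : Carrier → Carrier → ℕ → Carrier
  pochhammer q z ℕ.zero    = 1#
  pochhammer q z (ℕ.suc k) = pochhammer q z k * (1# + (- ((q ^ k) * z)))

  W₀ : ℕ → Carrier → Carrier
  W₀ n t = ∑ (permutations n) (λ w → t ^ length w)

------------------------------------------------------------------------
-- Laurent polynomials in n variables x₁ , … , xₙ

module LaurentPolynomials (R : RawRing c ℓ) (n : ℕ) where

  open RawRing R

  Exponent : Set
  Exponent = Vec ℤ n

  -- A finite formal sum of terms; the same exponent may occur repeatedly,
  -- and _≈ᴸ_ below is the equality of Laurent polynomials.
  Laurent : Set c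
  Laurent = List (Carrier × Exponent)

  coefficient : Exponent → Laurent → Carrier
  coefficient e []            = 0#
  coefficient e ((a , d) ∷ f) =
    if does (Vec.≡-dec ℤ._≟_ d e) then a + coefficient e f else coefficient e f

  _≈ᴸ_ : Laurent → Laurent → Set ℓ
  f ≈ᴸ g = ∀ e → coefficient e f ≈ coefficient e g

  ct : Laurent → Carrier
  ct = coefficient (Vec.replicate n ℤ.0ℤ)

  constant : Carrier → Laurent
  constant a = (a , Vec.replicate n ℤ.0ℤ) ∷ []

  laurentRing : RawRing c ℓ
  laurentRing = record
    { Carrier = Laurent
    ; _≈_     = _≈ᴸ_
    ; _+_     = _++_
    ; _*_     = List.cartesianProductWith
                  (λ (a , d) (b , e) → a * b , Vec.zipWith ℤ._+_ d e)
    ; -_      = List.map (λ (a , d) → - a , d)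
    ; 0#      = []
    ; 1#      = constant 1#
    }

  -- x i = xᵢ and x⁻¹ i = xᵢ⁻¹
  x x⁻¹ : Fin n → Laurent
  x   i = (1# , Vec.replicate n ℤ.0ℤ Vec.[ i ]≔ ℤ.+ 1) ∷ []
  x⁻¹ i = (1# , Vec.replicate n ℤ.0ℤ Vec.[ i ]≔ ℤ.- (ℤ.+ 1)) ∷ []

  -- f̄, for a given effect σ on the coefficients
  bar : (Carrier → Carrier) → Laurent → Laurent
  bar σ = List.map (λ (a , d) → σ a , Vec.map ℤ.-_ d)

  module _ (q : Carrier) (k : ℕ) where

    open RawRing laurentRing using () renaming (_*_ to _*ᴸ_)
    open RingOperations laurentRing

    -- 1 / (Δ∞ˣ Δ₀ˣ Δ∞ˣ⁻¹) at t = qᵏ: the infinite products telescope, and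
    -- what remains is ∏_{i<j} (xᵢxⱼ⁻¹;q)ₖ (q xᵢ⁻¹xⱼ;q)ₖ.
    weight : Laurent
    weight = ∏ (increasingPairs n) λ (i , j) →
      pochhammer (constant q) (x i *ᴸ x⁻¹ j) k *ᴸ
      pochhammer (constant q) (constant q *ᴸ (x⁻¹ i *ᴸ x j)) k

    -- 1 / (Δ∞ˣ Δ₀ˣ Δ₀ˣ⁻¹ Δ∞ˣ⁻¹) at t = qᵏ, likewise
    -- ∏_{i<j} (xᵢxⱼ⁻¹;q)ₖ (xᵢ⁻¹xⱼ;q)ₖ.
    symmetricWeight : Laurent
    symmetricWeight = ∏ (increasingPairs n) λ (i , j) →
      pochhammer (constant q) (x i *ᴸ x⁻¹ j) k *ᴸ
      pochhammer (constant q) (x⁻¹ i *ᴸ x j) k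

------------------------------------------------------------------------
-- Coefficient fields

-- The paradigm is ℚ(q): a field of characteristic 0 containing a q that is
-- not a root of unity, with an endomorphism taking q to q⁻¹.
record CoefficientField c ℓ₁ ℓ₂ : Set (suc (c ⊔ ℓ₁ ⊔ ℓ₂)) where
  field
    heytingField : HeytingField c ℓ₁ ℓ₂

  open HeytingField heytingField public

  commutativeRing : CommutativeRing c ℓ₁
  commutativeRing = record { isCommutativeRing = isCommutativeRing }

  rawRing : RawRing c ℓ₁
  rawRing = CommutativeRing.rawRing commutativeRing

  open RawSemiringDefinitions (RawRing.rawSemiring rawRing) public
    using (_^_) renaming (_×_ to _·_)
  open RingMorphisms rawRing rawRing using (IsRingHomomorphism)

  field
    characteristic-0   : ∀ m .{{_ : NonZero m}} → m · 1# # 0#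
    q                  : Carrier
    q-not-root-of-1    : ∀ m .{{_ : NonZero m}} → q ^ m # 1#
    conj               : Carrier → Carrier
    conj-homomorphism  : IsRingHomomorphism conj
    conj-q             : conj q * q ≈ 1#

module _ (𝔽 : CoefficientField c ℓ₁ ℓ₂) where

  open CoefficientField 𝔽
  open HeytingProperties (HeytingField.heytingCommutativeRing heytingField)
  open RingOperations rawRing

  module Division where

    infixl 7 _/_⟨_⟩

    _/_⟨_⟩ : Carrier → (y : Carrier) → y # 0# → Carrier
    x / y ⟨ y#0 ⟩ = x * proj₁ (#⇒invertible y#0)

  open Division

  module InnerProduct {n : ℕ} where

    open LaurentPolynomials rawRing n
    open RawRing laurentRing using () renaming (_*_ to _*ᴸ_)

    -- (f , g)_{q,t} at t = qᵏ; conj takes t to t⁻¹ as it takes q to q⁻¹.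
    innerProduct : ℕ → Laurent → Laurent → Carrier
    innerProduct k f g = ct ((f *ᴸ bar conj g) *ᴸ weight q k)

  module QBinomial where

    1-qʳ⁺¹#0 : ∀ r → 1# - q ^ r * q # 0#
    1-qʳ⁺¹#0 r =
      let y , y*[1-qʳ⁺¹]≈1 , _ = #⇒invertible 1#qʳ⁺¹
      in  invertibleˡ⇒# (y , trans (*-congˡ (x-0≈x _)) y*[1-qʳ⁺¹]≈1)
      where
      1#qʳ⁺¹ : 1# # q ^ r * q
      1#qʳ⁺¹ = #-sym (#-congʳ (*-comm q (q ^ r)) (q-not-root-of-1 (ℕ.suc r)))

    pochhammer#0 : ∀ m → pochhammer q q m # 0#
    pochhammer#0 ℕ.zero    = 1#0
    pochhammer#0 (ℕ.suc m) = x#0y#0→xy#0 (pochhammer#0 m) (1-qʳ⁺¹#0 m)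

    -- Meaningful only for b ≤ a, because of the truncated subtraction.
    qBinomial : ℕ → ℕ → Carrier
    qBinomial a b =
      pochhammer q q a /
        (pochhammer q q b * pochhammer q q (a ∸ b))
          ⟨ x#0y#0→xy#0 (pochhammer#0 b) (pochhammer#0 (a ∸ b)) ⟩

  -- For the normalisation 1/n! of the constant term of symmetricWeight, without
  -- which it is n! times 1/W₀(qᵏ) times that of weight (already
  -- ct ((1-z)(1-z⁻¹)) = 2 and ct ((1-z)(1-qz⁻¹)) = 1+q = W₀(q) for n = 2, k = 1).
  n!#0 : ∀ n → (n !) · 1# # 0#
  n!#0 n = characteristic-0 (n !) {{n !≢0}}

{-# OPTIONS --safe #-}
module Submission where

-- After multiplication by (x₁ ⋯ xₙ)^N with N = (n - 1)k, the constant term becomes the coefficient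
-- of (x₁ ⋯ xₙ)^N in a homogeneous polynomial of degree nN.  Interpolation in each variable at the
-- nodes 1, q, …, q^N expresses it as a weighted sum of the values at the points x = (q^(v₁), …,
-- q^(vₙ)) with 0 ≤ vᵢ ≤ N (the Károlyi–Nagy proof of the q-Dyson theorem).  A value vanishes as
-- soon as two coordinates of v are too close.  Since n points pairwise k apart fill the interval
-- [0, (n - 1)k] exactly, only v = (0, k, …, (n - 1)k) contributes for the first weight, and its n!
-- rearrangements, all equally, for the symmetric one.  The value at that point telescopes.  W₀ is
-- computed by inserting the image of the first point, which contributes its rank to the number of
-- inversions.

open import Defs
open import Algebra.Apartness.Bundles using (HeytingField)
open import Algebra.Bundles using (CommutativeRing; RawRing)
open import Algebra.Morphism.Structures using (module RingMorphisms)
open import Data.Bool using (true; false)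
open import Data.Fin as Fin using (Fin; toℕ)
open import Data.Fin.Permutation as Perm using (Permutation′; _⟨$⟩ʳ_)
open import Data.Integer as ℤ using (ℤ; +_; -[1+_])
open import Data.List as List using (List; []; _∷_; _++_)
open import Data.List.Membership.Propositional using (_∈_; _∉_)
open import Data.List.Membership.Propositional.Properties using (∈-∃++)
open import Data.List.Relation.Binary.Permutation.Propositional as ↭ using (_↭_; ↭-sym; ↭-trans; ↭-prep)
open import Data.List.Relation.Unary.All as All using (All; []; _∷_)
open import Data.List.Relation.Unary.AllPairs as AllPairs using (AllPairs; []; _∷_)
open import Data.List.Relation.Unary.Any using (here; there)
open import Data.List.Relation.Unary.Linked.Properties using (Linked⇒AllPairs)
open import Data.List.Relation.Unary.Unique.Propositional using (Unique)
open import Data.Nat as ℕ using (ℕ; zero; suc; _∸_; _!)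
open import Data.Product using (_×_; _,_; proj₁; Σ-syntax; ∃-syntax)
open import Data.Sum as Sum using (_⊎_; inj₁; inj₂)
open import Data.Vec as Vec using (Vec; []; _∷_)
open import Data.Vec.Relation.Unary.All as VecAll using ([]; _∷_)
open import Data.Vec.Relation.Unary.Any as VecAny using (here; there)
open import Function using (_∘_; id)
open import Level using (Level; _⊔_)
open import Relation.Binary.PropositionalEquality as ≡ using (_≡_)
open import Relation.Nullary using (Dec; yes; no; ¬_; does; contradiction)
open import Relation.Nullary.Decidable using (dec-true; dec-false)
open import Relation.Unary using (Pred; Decidable)
import Algebra.Apartness.Properties.HeytingCommutativeRing as HeytingProperties
import Algebra.Definitions.RawSemiring as RawSemiringDefinitions
import Algebra.Properties.CommutativeMonoid.Sum as CommutativeMonoidSum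
import Algebra.Properties.CommutativeSemigroup as CommutativeSemigroupProperties
import Algebra.Properties.Ring as RingProperties
import Algebra.Properties.Semiring.Exp as Exp
import Algebra.Properties.Semiring.Mult as Mult
import Algebra.Properties.Semiring.Sum as SemiringSum
import Data.Fin.Properties as Fin
import Data.Integer.Properties as ℤ
import Data.List.Properties as List
import Data.List.Relation.Binary.Permutation.Propositional.Properties as ↭
import Data.List.Relation.Binary.Permutation.Setoid.Properties as SetoidPermutation
import Data.List.Relation.Unary.All.Properties as All
import Data.List.Sort as Sort
import Data.Nat.ListAction as ℕ using (sum)
import Data.Nat.ListAction.Properties as ℕ using (sum-++)
import Data.Nat.Properties as ℕ
import Data.Vec.Properties as Vec
import Data.Vec.Relation.Unary.All.Properties as VecAll
import Relation.Binary.Reasoning.Setoid as SetoidReasoning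

open CommutativeMonoidSum ℕ.+-0-commutativeMonoid
  using () renaming (sum to sumℕ; sum-cong-≗ to sumℕ-cong; sum-permute to sumℕ-permute)

-- The factor (x₁ ⋯ xₙ)^N is never multiplied in: it is absorbed into the interpolation weights, and
-- Laurent terms are evaluated as they are. In one variable the resulting functional takes xᶻ to 1
-- for z = 0 and to 0 for -N ≤ z < 0, but in general not to 0 for z > 0. So it does not extract
-- constant terms on its own; but a nonconstant monomial of total degree 0 has a negative exponent,
-- and the zero from that coordinate kills the whole grid sum. Hence two facts are tracked for the
-- weights: degree 0 and the bound N on denominators.
--
-- The additional `q` in the first weight moves the zeros of the second Pochhammer symbol from 0 ≤
-- vᵢ - vⱼ < k to 0 < vᵢ - vⱼ ≤ k. This excludes a descent by exactly k and so singles out one order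
-- of the points.
--
-- The factor W₀(qᵏ) does not come from a symmetrisation argument: both constant terms are
-- evaluated, and up to n! their quotient is matched with W₀ = [1][2] ⋯ [n] factor by factor. The
-- case k = 0 is treated separately, as the points then coincide and 1 - qᵏ is not invertible.

private
  variable
    ℓ₁ ℓ₂ ℓ₃ ℓ₄ : Level
    A : Set ℓ₁
    B : Set ℓ₂
    n : ℕ

-- Pairs of indices and inversions

filter-map : ∀ {P : Pred B ℓ₃} (P? : Decidable P) (f : A → B) xs →
             List.filter P? (List.map f xs) ≡ List.map f (List.filter (P? ∘ f) xs)
filter-map P? f []       = ≡.refl
filter-map P? f (x ∷ xs) with does (P? (f x))
... | true  = ≡.cong (f x ∷_) (filter-map P? f xs)
... | false = filter-map P? f xs

filter-cong : ∀ {P : Pred A ℓ₃} {Q : Pred A ℓ₄} (P? : Decidable P) (Q? : Decidable Q) →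
              (∀ x → does (P? x) ≡ does (Q? x)) → ∀ xs → List.filter P? xs ≡ List.filter Q? xs
filter-cong P? Q? eq []       = ≡.refl
filter-cong P? Q? eq (x ∷ xs) rewrite eq x with does (Q? x)
... | true  = ≡.cong (x ∷_) (filter-cong P? Q? eq xs)
... | false = filter-cong P? Q? eq xs

allFin-suc : ∀ n → List.allFin (suc n) ≡ Fin.zero ∷ List.map Fin.suc (List.allFin n)
allFin-suc n = ≡.cong (Fin.zero ∷_) (≡.sym (List.map-tabulate id Fin.suc))

private
  ↑_ : Fin n × Fin n → Fin (suc n) × Fin (suc n)
  ↑ (i , j) = Fin.suc i , Fin.suc j

  <-pair? : (ij : Fin n × Fin n) → Dec _
  <-pair? (i , j) = i Fin.<? j

increasingPairs-suc : ∀ n →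
  increasingPairs (suc n) ≡
    List.map (λ j → Fin.zero , Fin.suc j) (List.allFin n) ++ List.map ↑_ (increasingPairs n)
increasingPairs-suc n =
  ≡.trans (≡.cong (λ is → List.filter <-pair? (List.cartesianProduct is is)) (allFin-suc n))
 (≡.trans (List.filter-++ <-pair? (List.map (Fin.zero ,_) (List.map Fin.suc xs)) _)
        (≡.cong₂ _++_ (≡.trans (≡.cong (List.filter <-pair?) (≡.sym (List.map-∘ xs)))
                           (first-row xs))
                    (other-rows xs)))
  where
  xs = List.allFin n

  first-row : ∀ (js : List (Fin n)) →
    List.filter <-pair? (List.map (λ j → Fin.zero {n = n} , Fin.suc j) js) ≡
    List.map (λ j → Fin.zero , Fin.suc j) js
  first-row []       = ≡.refl
  first-row (j ∷ js) = ≡.cong (_ ∷_) (first-row js)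

  row : ∀ i js →
    List.filter <-pair? (List.map (Fin.suc i ,_) (Fin.zero ∷ List.map Fin.suc js)) ≡
    List.map ↑_ (List.filter <-pair? (List.map (i ,_) js))
  row i js = begin
    List.filter <-pair? (List.map (Fin.suc i ,_) (List.map Fin.suc js))
      ≡⟨ ≡.cong (List.filter <-pair?) (≡.sym (List.map-∘ js)) ⟩
    List.filter <-pair? (List.map (λ j → Fin.suc i , Fin.suc j) js)
      ≡⟨ ≡.cong (List.filter <-pair?) (List.map-∘ js) ⟩
    List.filter <-pair? (List.map ↑_ (List.map (i ,_) js))
      ≡⟨ filter-map <-pair? ↑_ (List.map (i ,_) js) ⟩
    List.map ↑_ (List.filter (λ ij → <-pair? (↑ ij)) (List.map (i ,_) js))
      ≡⟨ ≡.cong (List.map ↑_) (filter-cong (λ ij → <-pair? (↑ ij)) <-pair? (λ _ → ≡.refl) (List.map (i ,_) js)) ⟩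
    List.map ↑_ (List.filter <-pair? (List.map (i ,_) js)) ∎
    where open ≡.≡-Reasoning

  other-rows : ∀ is →
    List.filter <-pair?
      (List.cartesianProduct (List.map Fin.suc is) (Fin.zero ∷ List.map Fin.suc xs)) ≡
    List.map ↑_ (List.filter <-pair? (List.cartesianProduct is xs))
  other-rows []       = ≡.refl
  other-rows (i ∷ is) = begin
    List.filter <-pair? (List.map (Fin.suc i ,_) (Fin.zero ∷ List.map Fin.suc xs) ++ rest)
      ≡⟨ List.filter-++ <-pair? (List.map (Fin.suc i ,_) (Fin.zero ∷ List.map Fin.suc xs)) rest ⟩
    List.filter <-pair? (List.map (Fin.suc i ,_) (Fin.zero ∷ List.map Fin.suc xs)) ++ List.filter <-pair? rest
      ≡⟨ ≡.cong₂ _++_ (row i xs) (other-rows is) ⟩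
    List.map ↑_ (List.filter <-pair? (List.map (i ,_) xs)) ++
      List.map ↑_ (List.filter <-pair? (List.cartesianProduct is xs))
      ≡⟨ List.map-++ ↑_ (List.filter <-pair? (List.map (i ,_) xs)) _ ⟨
    List.map ↑_ (List.filter <-pair? (List.map (i ,_) xs) ++ List.filter <-pair? (List.cartesianProduct is xs))
      ≡⟨ ≡.cong (List.map ↑_) (List.filter-++ <-pair? (List.map (i ,_) xs) (List.cartesianProduct is xs)) ⟨
    List.map ↑_ (List.filter <-pair? (List.map (i ,_) xs ++ List.cartesianProduct is xs)) ∎
    where
    open ≡.≡-Reasoning
    rest = List.cartesianProduct (List.map Fin.suc is) (Fin.zero ∷ List.map Fin.suc xs)

private
  [_] : Dec A → ℕ
  [ yes _ ] = 1
  [ no  _ ] = 0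

length-filter-allFin : ∀ n {P : Pred (Fin n) ℓ₃} (P? : Decidable P) →
  List.length (List.filter P? (List.allFin n)) ≡ sumℕ (λ i → [ P? i ])
length-filter-allFin zero    P? = ≡.refl
length-filter-allFin (suc n) P? =
  ≡.trans (≡.cong (List.length ∘ List.filter P?) (allFin-suc n)) step
  where
  tail-eq : List.length (List.filter P? (List.map Fin.suc (List.allFin n))) ≡
            sumℕ (λ i → [ P? (Fin.suc i) ])
  tail-eq = ≡.trans (≡.cong List.length (filter-map P? Fin.suc (List.allFin n)))
           (≡.trans (List.length-map Fin.suc (List.filter (P? ∘ Fin.suc) (List.allFin n)))
                  (length-filter-allFin n (P? ∘ Fin.suc)))

  step : List.length (List.filter P? (Fin.zero ∷ List.map Fin.suc (List.allFin n))) ≡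
         [ P? Fin.zero ] ℕ.+ sumℕ (λ i → [ P? (Fin.suc i) ])
  step with P? Fin.zero
  ... | yes _ = ≡.cong suc tail-eq
  ... | no  _ = tail-eq

private
  []-cong : {P : Set ℓ₃} {Q : Set ℓ₄} (P? : Dec P) (Q? : Dec Q) → (P → Q) → (Q → P) → [ P? ] ≡ [ Q? ]
  []-cong (yes p) (yes q) f g = ≡.refl
  []-cong (yes p) (no ¬q) f g = contradiction (f p) ¬q
  []-cong (no ¬p) (yes q) f g = contradiction (g q) ¬p
  []-cong (no ¬p) (no ¬q) f g = ≡.refl

sum-[<] : ∀ n m → m ℕ.≤ n → sumℕ {n} (λ i → [ toℕ i ℕ.<? m ]) ≡ m
sum-[<] zero    .zero   ℕ.z≤n = ≡.refl
sum-[<] (suc n) zero    _     = sum-[<] n zero ℕ.z≤n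
sum-[<] (suc n) (suc m) (ℕ.s≤s m≤n) =
  ≡.cong suc (≡.trans (sumℕ-cong {n} (λ i → []-cong (toℕ (Fin.suc i) ℕ.<? suc m) (toℕ i ℕ.<? m) ℕ.s≤s⁻¹ ℕ.s≤s))
                  (sum-[<] n m m≤n))

punchIn-< : ∀ (j : Fin (suc n)) a b → a Fin.< b → Fin.punchIn j a Fin.< Fin.punchIn j b
punchIn-< j a b a<b =
  ℕ.≤∧≢⇒< (Fin.punchIn-mono-≤ j a b (ℕ.<⇒≤ a<b))
          (λ eq → ℕ.<⇒≢ a<b (≡.cong toℕ (Fin.punchIn-injective j a b (Fin.toℕ-injective eq))))

punchIn-cancel-< : ∀ (j : Fin (suc n)) a b → Fin.punchIn j a Fin.< Fin.punchIn j b → a Fin.< b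
punchIn-cancel-< j a b lt =
  ℕ.≤∧≢⇒< (Fin.punchIn-cancel-≤ j a b (ℕ.<⇒≤ lt))
          (λ eq → ℕ.<⇒≢ lt (≡.cong (toℕ ∘ Fin.punchIn j) (Fin.toℕ-injective eq)))

punchIn<⇒< : ∀ (j : Fin (suc n)) a → Fin.punchIn j a Fin.< j → a Fin.< j
punchIn<⇒< (Fin.suc j) Fin.zero    _           = ℕ.z<s
punchIn<⇒< (Fin.suc j) (Fin.suc a) (ℕ.s≤s lt) = ℕ.s≤s (punchIn<⇒< j a lt)

<⇒punchIn< : ∀ (j : Fin (suc n)) a → a Fin.< j → Fin.punchIn j a Fin.< j
<⇒punchIn< (Fin.suc j) Fin.zero    _           = ℕ.z<s
<⇒punchIn< (Fin.suc j) (Fin.suc a) (ℕ.s≤s lt) = ℕ.s≤s (<⇒punchIn< j a lt)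

-- The value `j` in the first position is inverted with exactly the `toℕ j` smaller values, which
-- all come later; `punchIn j` is strictly increasing, so the inversions among the other positions
-- are those of `π`.
length-insert : ∀ (j : Fin (suc n)) (π : Permutation′ n) →
                length (Perm.insert Fin.zero j π) ≡ toℕ j ℕ.+ length π
length-insert {n} j π = begin
  List.length (List.filter inv? (increasingPairs (suc n)))
    ≡⟨ ≡.cong (List.length ∘ List.filter inv?) (increasingPairs-suc n) ⟩
  List.length (List.filter inv? (List.map z↑ (List.allFin n) ++ List.map ↑_ (increasingPairs n)))
    ≡⟨ ≡.cong List.length (List.filter-++ inv? (List.map z↑ (List.allFin n)) _) ⟩
  List.length (List.filter inv? (List.map z↑ (List.allFin n)) ++ List.filter inv? (List.map ↑_ (increasingPairs n)))
    ≡⟨ List.length-++ (List.filter inv? (List.map z↑ (List.allFin n))) ⟩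
  List.length (List.filter inv? (List.map z↑ (List.allFin n))) ℕ.+
  List.length (List.filter inv? (List.map ↑_ (increasingPairs n)))
    ≡⟨ ≡.cong₂ ℕ._+_ with-0 without-0 ⟩
  toℕ j ℕ.+ length π ∎
  where
  open ≡.≡-Reasoning
  ρ = Perm.insert Fin.zero j π

  inv? : ((a , b) : Fin (suc n) × Fin (suc n)) → Dec _
  inv? (a , b) = (ρ ⟨$⟩ʳ b) Fin.<? (ρ ⟨$⟩ʳ a)

  z↑ : Fin n → Fin (suc n) × Fin (suc n)
  z↑ b = Fin.zero , Fin.suc b

  ρ-suc : ∀ b → ρ ⟨$⟩ʳ Fin.suc b ≡ Fin.punchIn j (π ⟨$⟩ʳ b)
  ρ-suc = Perm.insert-punchIn Fin.zero j π

  with-0 : List.length (List.filter inv? (List.map z↑ (List.allFin n))) ≡ toℕ j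
  with-0 = begin
    List.length (List.filter inv? (List.map z↑ (List.allFin n)))
      ≡⟨ ≡.cong List.length (filter-map inv? z↑ (List.allFin n)) ⟩
    List.length (List.map z↑ (List.filter (inv? ∘ z↑) (List.allFin n)))
      ≡⟨ List.length-map z↑ (List.filter (inv? ∘ z↑) (List.allFin n)) ⟩
    List.length (List.filter (inv? ∘ z↑) (List.allFin n))
      ≡⟨ length-filter-allFin n (inv? ∘ z↑) ⟩
    sumℕ (λ b → [ inv? (z↑ b) ])
      ≡⟨ sumℕ-cong {n} (λ b → []-cong (inv? (z↑ b)) (toℕ (π ⟨$⟩ʳ b) ℕ.<? toℕ j)
           (λ lt → punchIn<⇒< j (π ⟨$⟩ʳ b) (≡.subst (Fin._< j) (ρ-suc b) lt))
           (λ lt → ≡.subst (Fin._< j) (≡.sym (ρ-suc b)) (<⇒punchIn< j (π ⟨$⟩ʳ b) lt))) ⟩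
    sumℕ {n} (λ b → [ toℕ (π ⟨$⟩ʳ b) ℕ.<? toℕ j ])
      -- Only the set of values counts here, so the sum is reindexed along `π`.
      ≡⟨ sumℕ-permute (λ b → [ toℕ b ℕ.<? toℕ j ]) π ⟨
    sumℕ {n} (λ b → [ toℕ b ℕ.<? toℕ j ])
      ≡⟨ sum-[<] n (toℕ j) (Fin.toℕ≤pred[n] j) ⟩
    toℕ j ∎

  π-inv? : ((a , b) : Fin n × Fin n) → Dec _
  π-inv? (a , b) = (π ⟨$⟩ʳ b) Fin.<? (π ⟨$⟩ʳ a)

  without-0 : List.length (List.filter inv? (List.map ↑_ (increasingPairs n))) ≡ length π
  without-0 = begin
    List.length (List.filter inv? (List.map ↑_ (increasingPairs n)))
      ≡⟨ ≡.cong List.length (filter-map inv? ↑_ (increasingPairs n)) ⟩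
    List.length (List.map ↑_ (List.filter (inv? ∘ ↑_) (increasingPairs n)))
      ≡⟨ List.length-map ↑_ (List.filter (inv? ∘ ↑_) (increasingPairs n)) ⟩
    List.length (List.filter (inv? ∘ ↑_) (increasingPairs n))
      ≡⟨ ≡.cong List.length (List.filter-≐ (inv? ∘ ↑_) π-inv?
           ((λ {(a , b)} lt → punchIn-cancel-< j (π ⟨$⟩ʳ b) (π ⟨$⟩ʳ a) (≡.subst₂ Fin._<_ (ρ-suc b) (ρ-suc a) lt))
           , (λ {(a , b)} lt → ≡.subst₂ Fin._<_ (≡.sym (ρ-suc b)) (≡.sym (ρ-suc a)) (punchIn-< j (π ⟨$⟩ʳ b) (π ⟨$⟩ʳ a) lt)))
           (increasingPairs n)) ⟩
    length π ∎

-- Finite products and sums, and the Poincaré polynomial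

module ListSums {c ℓ} (R : CommutativeRing c ℓ) where

  open CommutativeRing R
  open RingOperations rawRing
  open Exp semiring
  open RingProperties ring using (x[y-z]≈xy-xz)
  open CommutativeSemigroupProperties *-commutativeSemigroup using (interchange; x∙yz≈y∙xz)
  open SetoidReasoning setoid

  [x-y]+[y-z]≈x-z : ∀ x y z → (x - y) + (y - z) ≈ x - z
  [x-y]+[y-z]≈x-z x y z = begin
    (x - y) + (y - z)     ≈⟨ +-assoc _ _ _ ⟩
    x + (- y + (y - z))   ≈⟨ +-congˡ (+-assoc _ _ _) ⟨
    x + ((- y + y) - z)   ≈⟨ +-congˡ (+-congʳ (-‿inverseˡ y)) ⟩
    x + (0# - z)          ≈⟨ +-congˡ (+-identityˡ _) ⟩
    x - z                 ∎

  ∏-cong : ∀ (xs : List A) {f g : A → Carrier} → (∀ x → f x ≈ g x) → ∏ xs f ≈ ∏ xs g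
  ∏-cong []       f≈g = refl
  ∏-cong (x ∷ xs) f≈g = *-cong (f≈g x) (∏-cong xs f≈g)

  ∏-++ : ∀ (xs ys : List A) (f : A → Carrier) → ∏ (xs ++ ys) f ≈ ∏ xs f * ∏ ys f
  ∏-++ []       ys f = sym (*-identityˡ _)
  ∏-++ (x ∷ xs) ys f = trans (*-congˡ (∏-++ xs ys f)) (sym (*-assoc _ _ _))

  ∏-map : ∀ (g : A → B) xs (f : B → Carrier) → ∏ (List.map g xs) f ≈ ∏ xs (f ∘ g)
  ∏-map g []       f = refl
  ∏-map g (x ∷ xs) f = *-congˡ (∏-map g xs f)

  ∏-increasingPairs-suc : ∀ n (f : Fin (suc n) × Fin (suc n) → Carrier) →
    ∏ (increasingPairs (suc n)) f ≈
    ∏ (List.allFin n) (λ j → f (Fin.zero , Fin.suc j)) *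
    ∏ (increasingPairs n) (λ (i , j) → f (Fin.suc i , Fin.suc j))
  ∏-increasingPairs-suc n f = begin
    ∏ (increasingPairs (suc n)) f
      ≡⟨ ≡.cong (λ ps → ∏ ps f) (increasingPairs-suc n) ⟩
    ∏ (List.map (λ j → Fin.zero , Fin.suc j) (List.allFin n) ++
       List.map (λ (i , j) → Fin.suc i , Fin.suc j) (increasingPairs n)) f
      ≈⟨ ∏-++ (List.map (λ j → Fin.zero , Fin.suc j) (List.allFin n)) _ f ⟩
    _ ≈⟨ *-cong (∏-map _ (List.allFin n) f) (∏-map _ (increasingPairs n) f) ⟩
    _ ∎

  -- The largest index is split off first because the products met later arise that way:
  -- `W₀ (suc n)` yields the factor [n + 1], and the first of `suc n` points forms pairs with the
  -- `n` points after it.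
  ∏< : ℕ → (ℕ → Carrier) → Carrier
  ∏< zero    f = 1#
  ∏< (suc n) f = f n * ∏< n f

  ∏<-cong : ∀ n {f g} → (∀ i → f i ≈ g i) → ∏< n f ≈ ∏< n g
  ∏<-cong zero    f≈g = refl
  ∏<-cong (suc n) f≈g = *-cong (f≈g n) (∏<-cong n f≈g)

  ∏<-* : ∀ n f g → ∏< n (λ i → f i * g i) ≈ ∏< n f * ∏< n g
  ∏<-* zero    f g = sym (*-identityˡ _)
  ∏<-* (suc n) f g = trans (*-congˡ (∏<-* n f g)) (interchange _ _ _ _)

  ∏<-first : ∀ n f → ∏< (suc n) f ≈ f 0 * ∏< n (f ∘ suc)
  ∏<-first zero    f = refl
  ∏<-first (suc n) f = trans (*-congˡ (∏<-first n f)) (x∙yz≈y∙xz _ _ _)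

  ∑-cong : ∀ (xs : List A) {f g : A → Carrier} → (∀ x → f x ≈ g x) → ∑ xs f ≈ ∑ xs g
  ∑-cong []       f≈g = refl
  ∑-cong (x ∷ xs) f≈g = +-cong (f≈g x) (∑-cong xs f≈g)

  ∑-++ : ∀ (xs ys : List A) (f : A → Carrier) → ∑ (xs ++ ys) f ≈ ∑ xs f + ∑ ys f
  ∑-++ []       ys f = sym (+-identityˡ _)
  ∑-++ (x ∷ xs) ys f = trans (+-congˡ (∑-++ xs ys f)) (sym (+-assoc _ _ _))

  ∑-map : ∀ (g : A → B) xs (f : B → Carrier) → ∑ (List.map g xs) f ≈ ∑ xs (f ∘ g)
  ∑-map g []       f = refl
  ∑-map g (x ∷ xs) f = +-congˡ (∑-map g xs f)

  ∑-distribˡ : ∀ y (xs : List A) (f : A → Carrier) → ∑ xs (λ x → y * f x) ≈ y * ∑ xs f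
  ∑-distribˡ y []       f = sym (zeroʳ y)
  ∑-distribˡ y (x ∷ xs) f = trans (+-congˡ (∑-distribˡ y xs f)) (sym (distribˡ _ _ _))

  ∑-distribʳ : ∀ y (xs : List A) (f : A → Carrier) → ∑ xs (λ x → f x * y) ≈ ∑ xs f * y
  ∑-distribʳ y []       f = sym (zeroˡ y)
  ∑-distribʳ y (x ∷ xs) f = trans (+-congˡ (∑-distribʳ y xs f)) (sym (distribʳ _ _ _))

  ∑-cartesianProductWith : ∀ {d} {D : Set d} (h : A → B → D) xs ys (f : D → Carrier) →
    ∑ (List.cartesianProductWith h xs ys) f ≈ ∑ xs (λ x → ∑ ys (λ y → f (h x y)))
  ∑-cartesianProductWith h []       ys f = refl
  ∑-cartesianProductWith h (x ∷ xs) ys f =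
    trans (∑-++ (List.map (h x) ys) _ f)
          (+-cong (∑-map (h x) ys f) (∑-cartesianProductWith h xs ys f))

  -- [m] = 1 + t + ⋯ + tᵐ⁻¹ in Horner form. The quotient (1 - tᵐ)/(1 - t) would lose `t = 1`, the
  -- value of qᵏ at `k = 0`.
  qInteger : Carrier → ℕ → Carrier
  qInteger t zero    = 0#
  qInteger t (suc m) = 1# + t * qInteger t m

  ∑-allFin-^ : ∀ t m → ∑ (List.allFin m) (λ j → t ^ toℕ j) ≈ qInteger t m
  ∑-allFin-^ t zero    = refl
  ∑-allFin-^ t (suc m) = +-congˡ (begin
    ∑ (List.tabulate Fin.suc) (λ (j : Fin (suc m)) → t ^ toℕ j)
      ≡⟨ ≡.cong (λ js → ∑ js (λ (j : Fin (suc m)) → t ^ toℕ j)) (List.map-tabulate {n = m} id Fin.suc) ⟨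
    ∑ (List.map Fin.suc (List.allFin m)) (λ j → t ^ toℕ j)
      ≈⟨ ∑-map Fin.suc (List.allFin m) (λ j → t ^ toℕ j) ⟩
    ∑ (List.allFin m) (λ j → t * t ^ toℕ j)
      ≈⟨ ∑-distribˡ t (List.allFin m) (λ j → t ^ toℕ j) ⟩
    t * ∑ (List.allFin m) (λ j → t ^ toℕ j)
      ≈⟨ *-congˡ (∑-allFin-^ t m) ⟩
    t * qInteger t m ∎)

  qInteger-geometric : ∀ t m → qInteger t m * (1# - t) ≈ 1# - t ^ m
  qInteger-geometric t zero    = trans (zeroˡ _) (sym (-‿inverseʳ 1#))
  qInteger-geometric t (suc m) = begin
    (1# + t * qInteger t m) * (1# - t)
      ≈⟨ distribʳ _ _ _ ⟩
    1# * (1# - t) + t * qInteger t m * (1# - t)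
      ≈⟨ +-cong (*-identityˡ _) (trans (*-assoc _ _ _) (*-congˡ (qInteger-geometric t m))) ⟩
    (1# - t) + t * (1# - t ^ m)
      ≈⟨ +-congˡ (trans (x[y-z]≈xy-xz _ _ _) (+-congʳ (*-identityʳ t))) ⟩
    (1# - t) + (t - t * t ^ m)
      ≈⟨ [x-y]+[y-z]≈x-z _ _ _ ⟩
    1# - t * t ^ m ∎

  -- By `length-insert` the summand splits as `t ^ toℕ j * t ^ length w`, so the sum over all `j`
  -- and `w` factors, and the recursion gives the t-factorial [n]!.
  W₀≈∏qInteger : ∀ n t → W₀ n t ≈ ∏< n (qInteger t ∘ suc)
  W₀≈∏qInteger zero    t = +-identityʳ 1#
  W₀≈∏qInteger (suc n) t = begin
    W₀ (suc n) t
      ≈⟨ ∑-cartesianProductWith (Perm.insert Fin.zero) (List.allFin (suc n)) (permutations n) _ ⟩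
    ∑ (List.allFin (suc n)) (λ j → ∑ (permutations n) (λ w → t ^ length (Perm.insert Fin.zero j w)))
      ≈⟨ ∑-cong (List.allFin (suc n)) (λ j → trans
           (∑-cong (permutations n) (λ w → trans
              (reflexive (≡.cong (t ^_) (length-insert j w)))
              (^-homo-* t (toℕ j) (length w))))
           (∑-distribˡ (t ^ toℕ j) (permutations n) _)) ⟩
    ∑ (List.allFin (suc n)) (λ j → t ^ toℕ j * W₀ n t)
      ≈⟨ ∑-distribʳ (W₀ n t) (List.allFin (suc n)) _ ⟩
    ∑ (List.allFin (suc n)) (λ j → t ^ toℕ j) * W₀ n t
      ≈⟨ *-cong (∑-allFin-^ t (suc n)) (W₀≈∏qInteger n t) ⟩
    qInteger t (suc n) * ∏< n (qInteger t ∘ suc) ∎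

-- Sums over 0, ..., N

module BoundedSums {c ℓ} (R : CommutativeRing c ℓ) where

  open CommutativeRing R
  open SemiringSum semiring using (sum; sum-cong-≋; sum-replicate-zero; *-distribˡ-sum; *-distribʳ-sum)
  open CommutativeMonoidSum +-commutativeMonoid using (∑-distrib-+)
  open SetoidReasoning setoid

  Σ≤ : ℕ → (ℕ → Carrier) → Carrier
  Σ≤ N h = sum {suc N} (λ a → h (toℕ a))

  Σ≤-cong : ∀ N {f g} → (∀ a → a ℕ.≤ N → f a ≈ g a) → Σ≤ N f ≈ Σ≤ N g
  Σ≤-cong N f≈g = sum-cong-≋ {suc N} (λ a → f≈g (toℕ a) (Fin.toℕ≤pred[n] a))

  Σ≤-zero : ∀ N {f} → (∀ a → a ℕ.≤ N → f a ≈ 0#) → Σ≤ N f ≈ 0#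
  Σ≤-zero N f≈0 = trans (Σ≤-cong N f≈0) (sum-replicate-zero (suc N))

  Σ≤-distrib-+ : ∀ N f g → Σ≤ N (λ a → f a + g a) ≈ Σ≤ N f + Σ≤ N g
  Σ≤-distrib-+ N f g = ∑-distrib-+ {suc N} (f ∘ toℕ) (g ∘ toℕ)

  Σ≤-distribˡ : ∀ N x f → Σ≤ N (λ a → x * f a) ≈ x * Σ≤ N f
  Σ≤-distribˡ N x f = sym (*-distribˡ-sum {suc N} x (f ∘ toℕ))

  Σ≤-distribʳ : ∀ N x f → Σ≤ N (λ a → f a * x) ≈ Σ≤ N f * x
  Σ≤-distribʳ N x f = sym (*-distribʳ-sum {suc N} x (f ∘ toℕ))

  Σ≤-last : ∀ N f → Σ≤ (suc N) f ≈ Σ≤ N f + f (suc N)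
  Σ≤-last zero    f = begin
    f 0 + (f 1 + 0#)  ≈⟨ +-congˡ (+-comm _ _) ⟩
    f 0 + (0# + f 1)  ≈⟨ +-assoc _ _ _ ⟨
    (f 0 + 0#) + f 1  ∎
  Σ≤-last (suc N) f = begin
    f 0 + Σ≤ (suc N) (f ∘ suc)              ≈⟨ +-congˡ (Σ≤-last N (f ∘ suc)) ⟩
    f 0 + (Σ≤ N (f ∘ suc) + f (2 ℕ.+ N))    ≈⟨ +-assoc _ _ _ ⟨
    Σ≤ (suc N) f + f (2 ℕ.+ N)              ∎

  Σ≤-single : ∀ N f {t} → t ℕ.≤ N → (∀ a → a ℕ.≤ N → a ≡ t ⊎ f a ≈ 0#) → Σ≤ N f ≈ f t
  Σ≤-single zero    f {zero} _ _ = +-identityʳ _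
  Σ≤-single (suc N) f {zero} _ f≈0 =
    trans (+-congˡ (Σ≤-zero N (λ a a≤N → rest a (f≈0 (suc a) (ℕ.s≤s a≤N))))) (+-identityʳ _)
    where
    rest : ∀ a → suc a ≡ 0 ⊎ f (suc a) ≈ 0# → f (suc a) ≈ 0#
    rest a (inj₂ eq) = eq
  Σ≤-single (suc N) f {suc t} (ℕ.s≤s t≤N) f≈0 =
    trans (+-cong (first (f≈0 0 ℕ.z≤n)) (Σ≤-single N (f ∘ suc) t≤N (λ a a≤N → rest a (f≈0 (suc a) (ℕ.s≤s a≤N))))) (+-identityˡ _)
    where
    first : 0 ≡ suc t ⊎ f 0 ≈ 0# → f 0 ≈ 0#
    first (inj₂ eq) = eq
    rest : ∀ a → suc a ≡ suc t ⊎ f (suc a) ≈ 0# → a ≡ t ⊎ f (suc a) ≈ 0#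
    rest a (inj₁ eq) = inj₁ (ℕ.suc-injective eq)
    rest a (inj₂ eq) = inj₂ eq

-- Exponent vectors: total degree and lower bounds

total : Vec ℤ n → ℤ
total []       = + 0
total (z ∷ zs) = z ℤ.+ total zs

infix 7 _∙_

_∙_ : Vec ℤ n → Vec ℕ n → ℤ
[]       ∙ []       = + 0
(z ∷ zs) ∙ (a ∷ as) = z ℤ.* + a ℤ.+ zs ∙ as

0ᵛ : ∀ n → Vec ℤ n
0ᵛ n = Vec.replicate n (+ 0)

+-interchange : ∀ i j k l → (i ℤ.+ j) ℤ.+ (k ℤ.+ l) ≡ (i ℤ.+ k) ℤ.+ (j ℤ.+ l)
+-interchange = CommutativeSemigroupProperties.interchange ℤ.+-commutativeSemigroup

total-+ : ∀ (d e : Vec ℤ n) → total (Vec.zipWith ℤ._+_ d e) ≡ total d ℤ.+ total e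
total-+ []      []      = ≡.refl
total-+ (x ∷ d) (y ∷ e) = ≡.trans (≡.cong (λ z → (x ℤ.+ y) ℤ.+ z) (total-+ d e)) (+-interchange x y _ _)

total-0ᵛ : ∀ n → total (0ᵛ n) ≡ + 0
total-0ᵛ zero    = ≡.refl
total-0ᵛ (suc n) = ≡.trans (ℤ.+-identityˡ _) (total-0ᵛ n)

total-≔ : ∀ (i : Fin n) z → total (0ᵛ n Vec.[ i ]≔ z) ≡ z
total-≔ {suc n} Fin.zero    z = ≡.trans (≡.cong (λ y → z ℤ.+ y) (total-0ᵛ n)) (ℤ.+-identityʳ z)
total-≔ {suc n} (Fin.suc i) z = ≡.trans (ℤ.+-identityˡ _) (total-≔ i z)

∙-+ : ∀ (d e : Vec ℤ n) v → Vec.zipWith ℤ._+_ d e ∙ v ≡ d ∙ v ℤ.+ e ∙ v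
∙-+ []      []      []      = ≡.refl
∙-+ (x ∷ d) (y ∷ e) (a ∷ v) =
  ≡.trans (≡.cong₂ ℤ._+_ (ℤ.*-distribʳ-+ (+ a) x y) (∙-+ d e v)) (+-interchange (x ℤ.* + a) (y ℤ.* + a) _ _)

∙-0ᵛ : ∀ (v : Vec ℕ n) → 0ᵛ n ∙ v ≡ + 0
∙-0ᵛ []      = ≡.refl
∙-0ᵛ (a ∷ v) = ≡.cong₂ ℤ._+_ (ℤ.*-zeroˡ (+ a)) (∙-0ᵛ v)

∙-≔ : ∀ (i : Fin n) z v → (0ᵛ n Vec.[ i ]≔ z) ∙ v ≡ z ℤ.* + Vec.lookup v i
∙-≔ Fin.zero    z (a ∷ v) = ≡.trans (≡.cong (λ y → z ℤ.* + a ℤ.+ y) (∙-0ᵛ v)) (ℤ.+-identityʳ _)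
∙-≔ (Fin.suc i) z (a ∷ v) =
  ≡.trans (≡.cong₂ ℤ._+_ (ℤ.*-zeroˡ (+ a)) (∙-≔ i z v)) (ℤ.+-identityˡ _)

δ : Fin n → Fin n → ℕ
δ Fin.zero    Fin.zero    = 1
δ Fin.zero    (Fin.suc _) = 0
δ (Fin.suc _) Fin.zero    = 0
δ (Fin.suc i) (Fin.suc c) = δ i c

-- `b i` bounds the power of `xᵢ` in the denominator. There is no bound from above: in degree 0 a
-- nonzero exponent vector always has a negative entry, and that entry is what the interpolation
-- acts on.
Supported : ℤ → (Fin n → ℕ) → Vec ℤ n → Set
Supported t b d = total d ≡ t × (∀ i → ℤ.- + b i ℤ.≤ Vec.lookup d i)

Supported-+ : ∀ {t u} {b b′ : Fin n → ℕ} {d e} → Supported t b d → Supported u b′ e →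
              Supported (t ℤ.+ u) (λ i → b i ℕ.+ b′ i) (Vec.zipWith ℤ._+_ d e)
Supported-+ {b = b} {b′} {d} {e} (p , bd) (r , be) =
  ≡.trans (total-+ d e) (≡.cong₂ ℤ._+_ p r) ,
  λ i → ≡.subst₂ ℤ._≤_
    (≡.sym (ℤ.neg-distrib-+ (+ b i) (+ b′ i)))
    (≡.sym (Vec.lookup-zipWith ℤ._+_ i d e))
    (ℤ.+-mono-≤ (bd i) (be i))

Supported-weaken : ∀ {t} {b b′ : Fin n → ℕ} {d} → (∀ i → b i ℕ.≤ b′ i) → Supported t b d → Supported t b′ d
Supported-weaken b≤b′ (p , bd) = p , λ i → ℤ.≤-trans (ℤ.neg-mono-≤ (ℤ.+≤+ (b≤b′ i))) (bd i)

Supported-0ᵛ : ∀ (b : Fin n → ℕ) → Supported (+ 0) b (0ᵛ n)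
Supported-0ᵛ {n} b = total-0ᵛ n ,
  λ i → ≡.subst (ℤ.- + b i ℤ.≤_) (≡.sym (Vec.lookup-replicate i (+ 0))) (ℤ.neg-≤-pos {b i} {0})

Supported-x : ∀ (i : Fin n) → Supported (+ 1) (λ _ → 0) (0ᵛ n Vec.[ i ]≔ + 1)
Supported-x i = total-≔ i (+ 1) , bound i
  where
  bound : ∀ {n} (i c : Fin n) → + 0 ℤ.≤ Vec.lookup (0ᵛ n Vec.[ i ]≔ + 1) c
  bound Fin.zero    Fin.zero    = ℤ.+≤+ ℕ.z≤n
  bound Fin.zero    (Fin.suc c) = ℤ.≤-reflexive (≡.sym (Vec.lookup-replicate c (+ 0)))
  bound (Fin.suc i) Fin.zero    = ℤ.≤-refl
  bound (Fin.suc i) (Fin.suc c) = bound i c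

Supported-x⁻¹ : ∀ (i : Fin n) → Supported (ℤ.- + 1) (δ i) (0ᵛ n Vec.[ i ]≔ (ℤ.- + 1))
Supported-x⁻¹ i = total-≔ i (ℤ.- + 1) , bound i
  where
  bound : ∀ {n} (i c : Fin n) → ℤ.- + δ i c ℤ.≤ Vec.lookup (0ᵛ n Vec.[ i ]≔ (ℤ.- + 1)) c
  bound Fin.zero    Fin.zero    = ℤ.≤-refl
  bound Fin.zero    (Fin.suc c) = ℤ.≤-reflexive (≡.sym (Vec.lookup-replicate c (+ 0)))
  bound (Fin.suc i) Fin.zero    = ℤ.≤-refl
  bound (Fin.suc i) (Fin.suc c) = bound i c

-- This is -N ≤ z ≤ -1, written so that `m` is the argument that `nodeSum-q⁻` expects.
SmallNegative : ℕ → ℤ → Set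
SmallNegative N z = ∃[ m ] (z ≡ -[1+ m ] × m ℕ.< N)

-- The tail of a vector of total 0 need not have total 0, so the induction allows any total: without
-- a negative entry it is a natural number `m`, and `m ≡ 0` forces every entry to be 0.
smallNegative⊎nonNegative : ∀ N (d : Vec ℤ n) → (∀ i → ℤ.- + N ℤ.≤ Vec.lookup d i) →
  VecAny.Any (SmallNegative N) d ⊎ (∃[ m ] (total d ≡ + m × (m ≡ 0 → d ≡ 0ᵛ n)))
smallNegative⊎nonNegative N [] _ = inj₂ (0 , ≡.refl , λ _ → ≡.refl)
smallNegative⊎nonNegative N (-[1+ x ] ∷ d) -N≤ = inj₁ (here (x , ≡.refl , x<N N (-N≤ Fin.zero)))
  where
  x<N : ∀ N → ℤ.- + N ℤ.≤ -[1+ x ] → x ℕ.< N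
  x<N (suc N) (ℤ.-≤- x≤N) = ℕ.s≤s x≤N
smallNegative⊎nonNegative N (+ x ∷ d) -N≤ with smallNegative⊎nonNegative N d (-N≤ ∘ Fin.suc)
... | inj₁ neg           = inj₁ (there neg)
... | inj₂ (m , eq , d≡) = inj₂ (x ℕ.+ m , ≡.cong (ℤ._+_ (+ x)) eq ,
  λ x+m≡0 → ≡.cong₂ Vec._∷_ (≡.cong +_ (ℕ.m+n≡0⇒m≡0 x x+m≡0)) (d≡ (ℕ.m+n≡0⇒n≡0 x x+m≡0)))

supported⇒zero⊎smallNegative : ∀ N {b} {d : Vec ℤ n} → (∀ i → b i ℕ.≤ N) → Supported (+ 0) b d →
                  d ≡ 0ᵛ n ⊎ VecAny.Any (SmallNegative N) d
supported⇒zero⊎smallNegative N {d = d} b≤N supp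
  with total≡0 , bound ← Supported-weaken {b′ = λ _ → N} {d = d} b≤N supp
  with smallNegative⊎nonNegative N d bound
... | inj₁ neg           = inj₂ neg
... | inj₂ (m , eq , d≡) = inj₁ (d≡ (ℤ.+-injective (≡.trans (≡.sym eq) total≡0)))

sum-0 : ∀ {A : Set} (xs : List A) k → ℕ.sum (List.map (λ _ → k ℕ.* 0) xs) ≡ 0
sum-0 []       k = ≡.refl
sum-0 (x ∷ xs) k = ≡.cong₂ ℕ._+_ (ℕ.*-zeroʳ k) (sum-0 xs k)

sum-δ : ∀ k (c : Fin n) → ℕ.sum (List.map (λ j → k ℕ.* δ j c) (List.allFin n)) ≡ k
sum-δ {suc n} k c = ≡.trans (≡.cong (λ js → ℕ.sum (List.map (λ j → k ℕ.* δ j c) js)) (allFin-suc n)) (split c)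
  where
  split : ∀ c → k ℕ.* δ Fin.zero c ℕ.+ ℕ.sum (List.map (λ j → k ℕ.* δ j c) (List.map Fin.suc (List.allFin n))) ≡ k
  split c = ≡.trans (≡.cong (λ s → k ℕ.* δ Fin.zero c ℕ.+ ℕ.sum s) (≡.sym (List.map-∘ (List.allFin n)))) (cases c)
    where
    cases : ∀ c → k ℕ.* δ Fin.zero c ℕ.+ ℕ.sum (List.map (λ j → k ℕ.* δ (Fin.suc j) c) (List.allFin n)) ≡ k
    cases Fin.zero    = ≡.trans (≡.cong₂ ℕ._+_ (ℕ.*-identityʳ k) (sum-0 (List.allFin n) k)) (ℕ.+-identityʳ k)
    cases (Fin.suc c) = ≡.cong₂ ℕ._+_ (ℕ.*-zeroʳ k) (sum-δ k c)

-- Of the two Pochhammer symbols of a pair, the `k` factors with xᵢ/xⱼ can bring in xⱼ⁻¹, and the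
-- `k` factors with xⱼ/xᵢ can bring in xᵢ⁻¹.
pairBound : ℕ → Fin n × Fin n → Fin n → ℕ
pairBound k (i , j) c = k ℕ.* δ j c ℕ.+ k ℕ.* δ i c

-- Every index lies in n - 1 pairs and receives `k` from each; this is where N = (n - 1)k comes
-- from. The index 0 meets all pairs of the first row, any other index meets exactly one of them.
sum-pairBound : ∀ k (c : Fin n) → ℕ.sum (List.map (λ p → pairBound k p c) (increasingPairs n)) ≡ (n ∸ 1) ℕ.* k
sum-pairBound {suc n} k c = begin
  ℕ.sum (List.map (λ p → pairBound k p c) (increasingPairs (suc n)))
    ≡⟨ ≡.cong (λ ps → ℕ.sum (List.map (λ p → pairBound k p c) ps)) (increasingPairs-suc n) ⟩
  ℕ.sum (List.map (λ p → pairBound k p c) (row ++ rest))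
    ≡⟨ ≡.cong ℕ.sum (List.map-++ _ row rest) ⟩
  ℕ.sum (List.map (λ p → pairBound k p c) row ++ List.map (λ p → pairBound k p c) rest)
    ≡⟨ ℕ.sum-++ (List.map _ row) _ ⟩
  ℕ.sum (List.map (λ p → pairBound k p c) row) ℕ.+ ℕ.sum (List.map (λ p → pairBound k p c) rest)
    ≡⟨ ≡.cong₂ ℕ._+_ (≡.cong ℕ.sum (List.map-∘ (List.allFin n))) (≡.cong ℕ.sum (List.map-∘ (increasingPairs n))) ⟨
  ℕ.sum (List.map (λ j → pairBound k (Fin.zero , Fin.suc j) c) (List.allFin n)) ℕ.+
  ℕ.sum (List.map (λ (i , j) → pairBound k (Fin.suc i , Fin.suc j) c) (increasingPairs n))
    ≡⟨ cases c ⟩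
  n ℕ.* k ∎
  where
  open ≡.≡-Reasoning
  row rest : List (Fin (suc n) × Fin (suc n))
  row  = List.map (λ j → Fin.zero , Fin.suc j) (List.allFin n)
  rest = List.map (λ (i , j) → Fin.suc i , Fin.suc j) (increasingPairs n)

  sum-const : ∀ {A : Set} (xs : List A) {f : A → ℕ} {m} → (∀ x → f x ≡ m) → ℕ.sum (List.map f xs) ≡ List.length xs ℕ.* m
  sum-const []       f≡m = ≡.refl
  sum-const (x ∷ xs) f≡m = ≡.cong₂ ℕ._+_ (f≡m x) (sum-const xs f≡m)

  cases : ∀ c → ℕ.sum (List.map (λ j → pairBound k (Fin.zero , Fin.suc j) c) (List.allFin n)) ℕ.+
                ℕ.sum (List.map (λ (i , j) → pairBound k (Fin.suc i , Fin.suc j) c) (increasingPairs n)) ≡ n ℕ.* k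
  cases Fin.zero = ≡.trans
    (≡.cong₂ ℕ._+_
      (≡.trans (sum-const (List.allFin n) (λ _ → ≡.cong₂ ℕ._+_ (ℕ.*-zeroʳ k) (ℕ.*-identityʳ k)))
               (≡.cong (ℕ._* k) (List.length-tabulate {n = n} id)))
      (≡.trans (sum-const (increasingPairs n) (λ _ → ≡.cong₂ ℕ._+_ (ℕ.*-zeroʳ k) (ℕ.*-zeroʳ k)))
               (ℕ.*-zeroʳ (List.length (increasingPairs n)))))
    (ℕ.+-identityʳ _)
  cases (Fin.suc c) = ≡.trans
    (≡.cong₂ ℕ._+_
      (≡.trans (≡.cong ℕ.sum (List.map-cong (λ j → ≡.trans (≡.cong (k ℕ.* δ j c ℕ.+_) (ℕ.*-zeroʳ k)) (ℕ.+-identityʳ _)) (List.allFin n)))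
               (sum-δ k c))
      (sum-pairBound k c))
    (k+[n∸1]*k c)
    where
    -- The argument in `Fin n` excludes `n = 0`, where `n ∸ 1` is truncated and the equation would
    -- say `k ≡ 0`.
    k+[n∸1]*k : ∀ {n} → Fin n → k ℕ.+ (n ∸ 1) ℕ.* k ≡ n ℕ.* k
    k+[n∸1]*k {suc n} _ = ≡.refl

-- Degree and denominators of the weights

module LaurentSupport {c ℓ} (R : CommutativeRing c ℓ) (n : ℕ) where

  open CommutativeRing R
  open LaurentPolynomials rawRing n
  open RawRing laurentRing using () renaming (_+_ to _+ᴸ_; _*_ to _*ᴸ_; -_ to -ᴸ_; 1# to 1ᴸ)
  open RingOperations laurentRing using (∏; pochhammer)

  -- Every listed term has to comply, including terms that cancel in the sum; products and sums then
  -- inherit the property term by term.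
  SupportedIn : ℤ → (Fin n → ℕ) → Laurent → Set c
  SupportedIn t b = All (λ (_ , d) → Supported t b d)

  private
    variable
      t u : ℤ
      b b′ : Fin n → ℕ
      f g : Laurent

  supp-weaken : (∀ i → b i ℕ.≤ b′ i) → SupportedIn t b f → SupportedIn t b′ f
  supp-weaken b≤b′ = All.map (λ {(_ , d)} → Supported-weaken {d = d} b≤b′)

  supp-* : SupportedIn t b f → SupportedIn u b′ g →
           SupportedIn (t ℤ.+ u) (λ i → b i ℕ.+ b′ i) (f *ᴸ g)
  supp-* []                      sg = []
  supp-* {f = (_ , d) ∷ f} (sd ∷ sf) sg =
    All.++⁺ (All.map⁺ (All.map (λ {(_ , e)} se → Supported-+ {d = d} {e} sd se) sg)) (supp-* sf sg)

  supp-constant : ∀ b a → SupportedIn (+ 0) b (constant a)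
  supp-constant b a = Supported-0ᵛ b ∷ []

  supp-neg : SupportedIn t b f → SupportedIn t b (-ᴸ f)
  supp-neg sf = All.map⁺ sf

  supp-x/x : ∀ i j → SupportedIn (+ 0) (δ j) (x i *ᴸ x⁻¹ j)
  supp-x/x i j = supp-* {f = x i} {g = x⁻¹ j} (Supported-x i ∷ []) (Supported-x⁻¹ j ∷ [])

  supp-x\x : ∀ i j → SupportedIn (+ 0) (δ i) (x⁻¹ i *ᴸ x j)
  supp-x\x i j = supp-weaken (λ c → ℕ.≤-reflexive (ℕ.+-identityʳ (δ i c)))
    (supp-* {f = x⁻¹ i} {g = x j} (Supported-x⁻¹ i ∷ []) (Supported-x j ∷ []))

  open RawSemiringDefinitions (RawRing.rawSemiring laurentRing) using () renaming (_^_ to _^ᴸ_)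

  supp-constant-^ : ∀ a k → SupportedIn (+ 0) (λ _ → 0) (constant a ^ᴸ k)
  supp-constant-^ a zero    = supp-constant (λ _ → 0) 1#
  supp-constant-^ a (suc k) = supp-* {b = λ _ → 0} {f = constant a} {b′ = λ _ → 0} (supp-constant (λ _ → 0) a) (supp-constant-^ a k)

  -- Since `z` has degree 0, each factor 1 - aʳz is homogeneous of degree 0, and each of the `k`
  -- factors uses up the bound `b` once.
  supp-pochhammer : ∀ a z k → SupportedIn (+ 0) b z →
                    SupportedIn (+ 0) (λ i → k ℕ.* b i) (pochhammer (constant a) z k)
  supp-pochhammer         a z zero    sz = supp-constant (λ _ → 0) 1#
  supp-pochhammer {b = b} a z (suc k) sz =
    supp-weaken (λ i → ℕ.≤-reflexive (ℕ.+-comm (k ℕ.* b i) (b i)))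
      (supp-* (supp-pochhammer a z k sz)
              (All.++⁺ (supp-constant b 1#) (supp-neg (supp-* (supp-constant-^ a k) sz))))

  supp-∏ : ∀ {A : Set} (xs : List A) (B : A → Fin n → ℕ) (F : A → Laurent) →
           (∀ x → SupportedIn (+ 0) (B x) (F x)) →
           SupportedIn (+ 0) (λ i → ℕ.sum (List.map (λ x → B x i) xs)) (∏ xs F)
  supp-∏ []       B F sF = supp-constant (λ _ → 0) 1#
  supp-∏ (x ∷ xs) B F sF = supp-* (sF x) (supp-∏ xs B F sF)

  supp-increasingPairs : ∀ k (F : Fin n × Fin n → Laurent) →
    (∀ p → SupportedIn (+ 0) (pairBound k p) (F p)) →
    SupportedIn (+ 0) (λ _ → (n ∸ 1) ℕ.* k) (∏ (increasingPairs n) F)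
  supp-increasingPairs k F sF =
    supp-weaken (λ c → ℕ.≤-reflexive (sum-pairBound k c)) (supp-∏ (increasingPairs n) (pairBound k) F sF)

  supp-weight : ∀ q k → SupportedIn (+ 0) (λ _ → (n ∸ 1) ℕ.* k) (weight q k)
  supp-weight q k = supp-increasingPairs k _ λ (i , j) →
    supp-* (supp-pochhammer q _ k (supp-x/x i j))
           (supp-pochhammer q _ k (supp-* (supp-constant (λ _ → 0) q) (supp-x\x i j)))

  supp-symmetricWeight : ∀ q k → SupportedIn (+ 0) (λ _ → (n ∸ 1) ℕ.* k) (symmetricWeight q k)
  supp-symmetricWeight q k = supp-increasingPairs k _ λ (i , j) →
    supp-* (supp-pochhammer q _ k (supp-x/x i j))
           (supp-pochhammer q _ k (supp-x\x i j))

-- Sums over the grid of points with coordinates in 0, ..., N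

module GridSums {c ℓ} (R : CommutativeRing c ℓ) (N : ℕ) where

  open CommutativeRing R
  open BoundedSums R
  open SetoidReasoning setoid

  Bounded : ∀ {n} → Vec ℕ n → Set
  Bounded = VecAll.All (ℕ._≤ N)

  Σgrid : ∀ n → (Vec ℕ n → Carrier) → Carrier
  Σgrid zero    F = F []
  Σgrid (suc n) F = Σ≤ N (λ a → Σgrid n (λ v → F (a ∷ v)))

  Σgrid-cong : ∀ n {F G} → (∀ v → Bounded v → F v ≈ G v) → Σgrid n F ≈ Σgrid n G
  Σgrid-cong zero    F≈G = F≈G [] []
  Σgrid-cong (suc n) F≈G = Σ≤-cong N λ a a≤N → Σgrid-cong n λ v v≤N → F≈G (a ∷ v) (a≤N ∷ v≤N)

  Σgrid-zero : ∀ n {F} → (∀ v → Bounded v → F v ≈ 0#) → Σgrid n F ≈ 0#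
  Σgrid-zero zero    F≈0 = F≈0 [] []
  Σgrid-zero (suc n) F≈0 = Σ≤-zero N λ a a≤N → Σgrid-zero n λ v v≤N → F≈0 (a ∷ v) (a≤N ∷ v≤N)

  Σgrid-distrib-+ : ∀ n F G → Σgrid n (λ v → F v + G v) ≈ Σgrid n F + Σgrid n G
  Σgrid-distrib-+ zero    F G = refl
  Σgrid-distrib-+ (suc n) F G =
    trans (Σ≤-cong N λ a _ → Σgrid-distrib-+ n (λ v → F (a ∷ v)) (λ v → G (a ∷ v)))
          (Σ≤-distrib-+ N (λ a → Σgrid n (λ v → F (a ∷ v))) (λ a → Σgrid n (λ v → G (a ∷ v))))

  Σgrid-distribˡ : ∀ n x F → Σgrid n (λ v → x * F v) ≈ x * Σgrid n F
  Σgrid-distribˡ zero    x F = refl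
  Σgrid-distribˡ (suc n) x F =
    trans (Σ≤-cong N λ a _ → Σgrid-distribˡ n x (λ v → F (a ∷ v)))
          (Σ≤-distribˡ N x (λ a → Σgrid n (λ v → F (a ∷ v))))

  Σgrid-single : ∀ n F w → Bounded w → (∀ v → Bounded v → v ≡ w ⊎ F v ≈ 0#) → Σgrid n F ≈ F w
  Σgrid-single zero    F []      _             _   = refl
  Σgrid-single (suc n) F (b ∷ w) (b≤N ∷ w≤N) F≈0 =
    trans (Σ≤-single N _ b≤N column) (Σgrid-single n (λ v → F (b ∷ v)) w w≤N λ v v≤N → tail v (F≈0 (b ∷ v) (b≤N ∷ v≤N)))
    where
    tail : ∀ v → b ∷ v ≡ b ∷ w ⊎ F (b ∷ v) ≈ 0# → v ≡ w ⊎ F (b ∷ v) ≈ 0#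
    tail v (inj₁ eq) = inj₁ (Vec.∷-injectiveʳ eq)
    tail v (inj₂ eq) = inj₂ eq

    column : ∀ a → a ℕ.≤ N → a ≡ b ⊎ Σgrid n (λ v → F (a ∷ v)) ≈ 0#
    column a a≤N with a ℕ.≟ b
    ... | yes a≡b = inj₁ a≡b
    ... | no  a≢b = inj₂ (Σgrid-zero n λ v v≤N → vanish v (F≈0 (a ∷ v) (a≤N ∷ v≤N)))
      where
      vanish : ∀ v → a ∷ v ≡ b ∷ w ⊎ F (a ∷ v) ≈ 0# → F (a ∷ v) ≈ 0#
      vanish v (inj₁ eq) = contradiction (Vec.∷-injectiveˡ eq) a≢b
      vanish v (inj₂ eq) = eq

-- Points at mutual distance at least k

progression : ℕ → ℕ → ∀ n → Vec ℕ n
progression k a zero    = []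
progression k a (suc n) = a ∷ progression k (k ℕ.+ a) n

Apart : ℕ → ℕ → ℕ → Set
Apart k a b = a ℕ.+ k ℕ.≤ b ⊎ b ℕ.+ k ℕ.≤ a

-- The strict inequality reflects the additional `q` in (q xᵢ⁻¹xⱼ;q)ₖ: for k ≥ 1 a descent by
-- exactly `k` is a zero of the weight, an ascent by exactly `k` is not.
OrderedApart : ℕ → ℕ → ℕ → Set
OrderedApart k a b = a ℕ.+ k ℕ.≤ b ⊎ b ℕ.+ k ℕ.< a

module _ (k : ℕ) where

  private
    prog : ℕ → ∀ n → List ℕ
    prog a n = Vec.toList (progression k a n)

  -- There is no slack: the entries after `x` are at least `k + a`, so by induction they form the
  -- progression from `k + a`, and then `x + k ≤ k + a` leaves only `x = a`.
  increasing⇒progression : ∀ a n s → List.length s ≡ n → AllPairs (λ x y → x ℕ.+ k ℕ.≤ y) s →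
    All (a ℕ.≤_) s → All (ℕ._≤ a ℕ.+ (n ∸ 1) ℕ.* k) s → s ≡ prog a n
  increasing⇒progression a zero          []          _  _ _ _ = ≡.refl
  increasing⇒progression a (suc zero)    (x ∷ [])    _  _ (a≤x ∷ _) (x≤a ∷ _) =
    ≡.cong (_∷ []) (ℕ.≤-antisym (≡.subst (x ℕ.≤_) (ℕ.+-identityʳ a) x≤a) a≤x)
  increasing⇒progression a (suc (suc n)) (x ∷ y ∷ s) eq (x≤ ∷ s↗) (a≤x ∷ _) (_ ∷ s≤) =
    ≡.cong₂ _∷_ (ℕ.≤-antisym x≤a a≤x) tail≡
    where
    tail≡ : y ∷ s ≡ prog (k ℕ.+ a) (suc n)
    tail≡ = increasing⇒progression (k ℕ.+ a) (suc n) (y ∷ s) (ℕ.suc-injective eq) s↗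
      (All.map (ℕ.≤-trans (≡.subst (ℕ._≤ x ℕ.+ k) (ℕ.+-comm a k) (ℕ.+-monoˡ-≤ k a≤x))) x≤)
      (All.map (λ {z} → ≡.subst (z ℕ.≤_) (≡.trans (≡.sym (ℕ.+-assoc a k _)) (≡.cong (ℕ._+ n ℕ.* k) (ℕ.+-comm a k)))) s≤)

    x≤a : x ℕ.≤ a
    x≤a = ℕ.+-cancelʳ-≤ k x a (≡.subst (x ℕ.+ k ℕ.≤_)
      (≡.trans (List.∷-injectiveˡ tail≡) (ℕ.+-comm k a)) (All.head x≤))

  -- `Apart k` is symmetric and therefore survives sorting, after which it becomes a gap of `k` from
  -- each entry to every later one.
  apart⇒↭progression : ∀ {n} (v : Vec ℕ n) → AllPairs (Apart k) (Vec.toList v) →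
    All (ℕ._≤ (n ∸ 1) ℕ.* k) (Vec.toList v) → Vec.toList v ↭ prog 0 n
  apart⇒↭progression {n} v apart v≤ =
    ↭-trans (↭-sym (sort-↭ (Vec.toList v)))
      (↭.↭-reflexive (increasing⇒progression 0 n (sort (Vec.toList v))
        (≡.trans (↭.↭-length (sort-↭ (Vec.toList v))) (Vec.length-toList v))
        (AllPairs.zipWith gap
          ( Linked⇒AllPairs ℕ.≤-trans (sort-↗ (Vec.toList v))
          , SetoidPermutation.AllPairs-resp-↭ (≡.setoid ℕ) Sum.swap (≡.resp₂ (Apart k))
              (↭.↭⇒↭ₛ (↭-sym (sort-↭ (Vec.toList v)))) apart))
        (All.universal (λ _ → ℕ.z≤n) _)
        (↭.All-resp-↭ (↭-sym (sort-↭ (Vec.toList v))) v≤)))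
    where
    open Sort ℕ.≤-decTotalOrder
    gap : ∀ {x y} → x ℕ.≤ y × Apart k x y → x ℕ.+ k ℕ.≤ y
    gap (x≤y , inj₁ x+k≤y) = x+k≤y
    -- Together with `x ≤ y` this case forces `k = 0`.
    gap (x≤y , inj₂ y+k≤x) = ℕ.≤-trans (ℕ.+-monoˡ-≤ k x≤y) (ℕ.≤-trans y+k≤x x≤y)

  -- Its use is to provide, for a term other than the first, the term `k` below it.
  ∈-progression : ∀ {x} a n → x ∈ prog a n → x ≡ a ⊎ (∃[ y ] (y ∈ prog a n × x ≡ k ℕ.+ y))
  ∈-progression a (suc n) (here x≡a) = inj₁ x≡a
  ∈-progression a (suc n) (there x∈) with ∈-progression (k ℕ.+ a) n x∈
  ... | inj₁ x≡k+a         = inj₂ (a , here ≡.refl , x≡k+a)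
  ... | inj₂ (y , y∈ , eq) = inj₂ (y , there y∈ , eq)

  progression-≥ : ∀ a n → All (a ℕ.≤_) (prog a n)
  progression-≥ a zero    = []
  progression-≥ a (suc n) = ℕ.≤-refl ∷ All.map (ℕ.≤-trans (ℕ.m≤n+m a k)) (progression-≥ (k ℕ.+ a) n)

  progression-≤ : ∀ a n → VecAll.All (ℕ._≤ a ℕ.+ (n ∸ 1) ℕ.* k) (progression k a n)
  progression-≤ a zero          = []
  progression-≤ a (suc zero)    = ℕ.m≤m+n a _ ∷ []
  progression-≤ a (suc (suc n)) = ℕ.m≤m+n a _ ∷
    VecAll.map (λ {z} → ≡.subst (z ℕ.≤_) (≡.trans (≡.cong (ℕ._+ n ℕ.* k) (ℕ.+-comm k a)) (ℕ.+-assoc a k _)))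
      (progression-≤ (k ℕ.+ a) (suc n))

  module _ (1≤k : 1 ℕ.≤ k) where

    k+x≰x : ∀ {x} → ¬ k ℕ.+ x ℕ.≤ x
    k+x≰x {x} = ℕ.<⇒≱ (ℕ.+-monoˡ-≤ x 1≤k)

    -- If the head x were not the least term a, then x - k would come later, but neither
    -- x + k ≤ x - k nor (x - k) + k < x.
    orderedApart∧↭⇒≡ : ∀ a {n} (v : Vec ℕ n) → AllPairs (OrderedApart k) (Vec.toList v) →
      Vec.toList v ↭ prog a n → v ≡ progression k a n
    orderedApart∧↭⇒≡ a []      _           _ = ≡.refl
    orderedApart∧↭⇒≡ a {suc n} (x ∷ v) (x# ∷ v#) p
      with ∈-progression a (suc n) (↭.∈-resp-↭ p (here ≡.refl))
    ... | inj₁ ≡.refl = ≡.cong (x ∷_) (orderedApart∧↭⇒≡ (k ℕ.+ x) v v# (↭.drop-∷ p))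
    ... | inj₂ (y , y∈ , ≡.refl) with ↭.∈-resp-↭ (↭-sym p) y∈
    ...   | here y≡k+y = contradiction (ℕ.≤-reflexive (≡.sym y≡k+y)) k+x≰x
    ...   | there y∈v with All.lookup x# y∈v
    ...     | inj₁ le = contradiction (ℕ.≤-trans (ℕ.m≤m+n (k ℕ.+ y) k) le) k+x≰x
    ...     | inj₂ lt = contradiction lt (ℕ.<-irrefl (ℕ.+-comm y k))

    progression-unique : ∀ a n → Unique (prog a n)
    progression-unique a zero    = []
    progression-unique a (suc n) =
      All.map (λ { le ≡.refl → k+x≰x le }) (progression-≥ (k ℕ.+ a) n) ∷ progression-unique (k ℕ.+ a) n

    orderedApart⇒≡progression : ∀ {n} (v : Vec ℕ n) → AllPairs (OrderedApart k) (Vec.toList v) →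
      All (ℕ._≤ (n ∸ 1) ℕ.* k) (Vec.toList v) → v ≡ progression k 0 n
    orderedApart⇒≡progression v v# v≤ = orderedApart∧↭⇒≡ 0 v v#
      (apart⇒↭progression v (AllPairs.map (Sum.map₂ ℕ.<⇒≤) v#) v≤)

-- Grid sums supported on the rearrangements of one point

module PermutationSums {c ℓ} (R : CommutativeRing c ℓ) (N : ℕ) where

  open CommutativeRing R
  open BoundedSums R
  open GridSums R N
  open Mult semiring renaming (_×_ to _·_)
  open SetoidReasoning setoid

  -- The induction removes one point `t` of the list at a time, splitting `f` into its part at `t`
  -- and its part elsewhere. As there are no repetitions, the latter still takes the value `x` on
  -- the rest of the list.
  Σ≤-indicator : ∀ T {f x} → Unique T → All (ℕ._≤ N) T → (∀ a → a ∈ T → f a ≈ x) →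
    (∀ a → a ℕ.≤ N → a ∉ T → f a ≈ 0#) → Σ≤ N f ≈ List.length T · x
  Σ≤-indicator []      _          _           _   f≈0 = Σ≤-zero N (λ a a≤N → f≈0 a a≤N λ ())
  Σ≤-indicator (t ∷ T) {f} {x} (t∉T ∷ uT) (t≤N ∷ T≤N) f≈x f≈0 = begin
    Σ≤ N f
      ≈⟨ Σ≤-cong N (λ a _ → split a) ⟩
    Σ≤ N (λ a → at-t a + off-t a)
      ≈⟨ Σ≤-distrib-+ N at-t off-t ⟩
    Σ≤ N at-t + Σ≤ N off-t
      ≈⟨ +-cong (trans (Σ≤-single N at-t t≤N (λ a _ → at-t-support a)) at-t-t)
                (Σ≤-indicator T uT T≤N off-t-∈ off-t-∉) ⟩
    x + List.length T · x ∎
    where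
    at-t off-t : ℕ → Carrier
    at-t a with a ℕ.≟ t
    ... | yes _ = x
    ... | no  _ = 0#
    off-t a with a ℕ.≟ t
    ... | yes _ = 0#
    ... | no  _ = f a

    split : ∀ a → f a ≈ at-t a + off-t a
    split a with a ℕ.≟ t
    ... | yes ≡.refl = trans (f≈x a (here ≡.refl)) (sym (+-identityʳ x))
    ... | no  _      = sym (+-identityˡ _)

    at-t-support : ∀ a → a ≡ t ⊎ at-t a ≈ 0#
    at-t-support a with a ℕ.≟ t
    ... | yes a≡t = inj₁ a≡t
    ... | no  _   = inj₂ refl

    at-t-t : at-t t ≈ x
    at-t-t with t ℕ.≟ t
    ... | yes _   = refl
    ... | no  t≢t = contradiction ≡.refl t≢t

    off-t-∈ : ∀ a → a ∈ T → off-t a ≈ x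
    off-t-∈ a a∈T with a ℕ.≟ t
    ... | yes ≡.refl = contradiction ≡.refl (All.lookup t∉T a∈T)
    ... | no  _      = f≈x a (there a∈T)

    off-t-∉ : ∀ a → a ℕ.≤ N → a ∉ T → off-t a ≈ 0#
    off-t-∉ a a≤N a∉T with a ℕ.≟ t
    ... | yes _   = refl
    ... | no  a≢t = f≈0 a a≤N λ { (here a≡t) → a≢t a≡t ; (there a∈T) → a∉T a∈T }

  -- The rearrangements are counted, not listed: the first coordinate is one of the `suc n` distinct
  -- entries of `T`, and the others rearrange `T` with that entry removed.
  Σgrid-permutations : ∀ n T {F x} → List.length T ≡ n → Unique T → All (ℕ._≤ N) T →
    (∀ v → Vec.toList v ↭ T → F v ≈ x) →
    (∀ v → Bounded v → ¬ (Vec.toList v ↭ T) → F v ≈ 0#) →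
    Σgrid n F ≈ (n !) · x
  Σgrid-permutations zero    []      _   _  _   F≈x _   = trans (F≈x [] ↭.refl) (sym (+-identityʳ _))
  Σgrid-permutations (suc n) T {F} {x} len uT T≤N F≈x F≈0 = begin
    Σ≤ N (λ a → Σgrid n (λ v → F (a ∷ v)))
      ≈⟨ Σ≤-indicator T uT T≤N inside outside ⟩
    List.length T · ((n !) · x)
      ≡⟨ ≡.cong (_· ((n !) · x)) len ⟩
    suc n · ((n !) · x)
      ≈⟨ ×-assocˡ x (suc n) (n !) ⟩
    (suc n !) · x ∎
    where
    outside : ∀ a → a ℕ.≤ N → a ∉ T → Σgrid n (λ v → F (a ∷ v)) ≈ 0#
    outside a a≤N a∉T = Σgrid-zero n λ v v≤N → F≈0 (a ∷ v) (a≤N ∷ v≤N)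
      λ p → a∉T (↭.∈-resp-↭ p (here ≡.refl))

    inside : ∀ a → a ∈ T → Σgrid n (λ v → F (a ∷ v)) ≈ (n !) · x
    inside a a∈T with ys , zs , ≡.refl ← ∈-∃++ a∈T = Σgrid-permutations n (ys ++ zs)
      (ℕ.suc-injective (≡.trans (≡.sym (↭.↭-length p)) len))
      (AllPairs.tail (SetoidPermutation.Unique-resp-↭ (≡.setoid ℕ) (↭.↭⇒↭ₛ p) uT))
      (All.tail (↭.All-resp-↭ p T≤N))
      (λ v v↭ → F≈x (a ∷ v) (↭-trans (↭-prep a v↭) (↭-sym p)))
      (λ v v≤N ¬v↭ → F≈0 (a ∷ v) (All.lookup T≤N a∈T ∷ v≤N) (λ av↭ → ¬v↭ (↭.drop-∷ (↭-trans av↭ p))))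
      where
      p : ys ++ a ∷ zs ↭ a ∷ (ys ++ zs)
      p = ↭.shift a ys zs

-- Powers of q, q-factorials and interpolation weights

-- This is what the evaluation asks of the coefficients: `q` and all 1 - qᵐ with m ≥ 1 are
-- invertible. With the inverses given as data only ring identities remain, and apartness is
-- confined to the end.
record QParameter {c ℓ} (R : CommutativeRing c ℓ) : Set (c ⊔ ℓ) where
  open CommutativeRing R
  open Exp semiring using (_^_)
  field
    q q⁻¹               : Carrier
    q⁻¹*q≈1             : q⁻¹ * q ≈ 1#
    1/[1-q^1+_]         : ℕ → Carrier
    1/[1-q^1+]-inverse  : ∀ m → 1/[1-q^1+ m ] * (1# - q ^ suc m) ≈ 1#

module ConstantTerms {c ℓ} {R : CommutativeRing c ℓ} (Q : QParameter R) where

  open CommutativeRing R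
  open QParameter Q
  open RingOperations rawRing
  open Exp semiring
  open Mult semiring renaming (_×_ to _·_)
  open ListSums R
  open BoundedSums R
  open RingProperties ring
  open CommutativeSemigroupProperties *-commutativeSemigroup
  open SetoidReasoning setoid

  q^_ : ℤ → Carrier
  q^ (+ m)      = q ^ m
  q^ (-[1+ m ]) = q⁻¹ ^ suc m

  q^-⊖ : ∀ m n → q^ (m ℤ.⊖ n) ≈ q ^ m * q⁻¹ ^ n
  q^-⊖ zero    zero    = sym (*-identityˡ _)
  q^-⊖ zero    (suc n) = sym (*-identityˡ _)
  q^-⊖ (suc m) zero    = sym (*-identityʳ _)
  q^-⊖ (suc m) (suc n) = begin
    q^ (suc m ℤ.⊖ suc n)              ≡⟨ ≡.cong q^_ (ℤ.[1+m]⊖[1+n]≡m⊖n m n) ⟩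
    q^ (m ℤ.⊖ n)                      ≈⟨ q^-⊖ m n ⟩
    q ^ m * q⁻¹ ^ n                   ≈⟨ *-identityˡ _ ⟨
    1# * (q ^ m * q⁻¹ ^ n)            ≈⟨ *-congʳ (trans (*-comm q q⁻¹) q⁻¹*q≈1) ⟨
    (q * q⁻¹) * (q ^ m * q⁻¹ ^ n)     ≈⟨ interchange _ _ _ _ ⟩
    (q * q ^ m) * (q⁻¹ * q⁻¹ ^ n)     ∎

  q^-homo : ∀ i j → q^ (i ℤ.+ j) ≈ q^ i * q^ j
  q^-homo (+ m)      (+ n)      = ^-homo-* q m n
  q^-homo (+ m)      (-[1+ n ]) = q^-⊖ m (suc n)
  q^-homo (-[1+ m ]) (+ n)      = trans (q^-⊖ n (suc m)) (*-comm _ _)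
  q^-homo (-[1+ m ]) (-[1+ n ]) = begin
    q⁻¹ ^ (2 ℕ.+ (m ℕ.+ n))    ≡⟨ ≡.cong (λ k → q⁻¹ ^ suc k) (ℕ.+-suc m n) ⟨
    q⁻¹ ^ (suc m ℕ.+ suc n)    ≈⟨ ^-homo-* q⁻¹ (suc m) (suc n) ⟩
    q⁻¹ ^ suc m * q⁻¹ ^ suc n  ∎

  q^-*+ : ∀ e a → q^ (e ℤ.* + a) ≈ (q^ e) ^ a
  q^-*+ e zero    = reflexive (≡.cong q^_ (ℤ.*-zeroʳ e))
  q^-*+ e (suc a) = begin
    q^ (e ℤ.* + suc a)       ≡⟨ ≡.cong q^_ (ℤ.*-suc e (+ a)) ⟩
    q^ (e ℤ.+ e ℤ.* + a)     ≈⟨ q^-homo e (e ℤ.* + a) ⟩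
    q^ e * q^ (e ℤ.* + a)    ≈⟨ *-congˡ (q^-*+ e a) ⟩
    q^ e * (q^ e) ^ a        ∎

  q^-neg-^ : ∀ m → q^ (ℤ.- + m) ≈ q⁻¹ ^ m
  q^-neg-^ zero    = refl
  q^-neg-^ (suc m) = refl

  q⁻¹^*q^ : ∀ m → q⁻¹ ^ m * q ^ m ≈ 1#
  q⁻¹^*q^ zero    = *-identityˡ _
  q⁻¹^*q^ (suc m) = begin
    (q⁻¹ * q⁻¹ ^ m) * (q * q ^ m)  ≈⟨ interchange _ _ _ _ ⟩
    (q⁻¹ * q) * (q⁻¹ ^ m * q ^ m)  ≈⟨ *-cong q⁻¹*q≈1 (q⁻¹^*q^ m) ⟩
    1# * 1#                        ≈⟨ *-identityˡ _ ⟩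
    1#                             ∎

  -- ⟨ m ⟩! = (q;q)ₘ and ⟨ m ⟩!⁻ = (q⁻¹;q⁻¹)ₘ
  ⟨_⟩! ⟨_⟩!⁻ 1/⟨_⟩! 1/⟨_⟩!⁻ : ℕ → Carrier

  ⟨ zero  ⟩! = 1#
  ⟨ suc m ⟩! = ⟨ m ⟩! * (1# - q ^ suc m)

  ⟨ zero  ⟩!⁻ = 1#
  ⟨ suc m ⟩!⁻ = ⟨ m ⟩!⁻ * (1# - q⁻¹ ^ suc m)

  1/⟨ zero  ⟩! = 1#
  1/⟨ suc m ⟩! = 1/⟨ m ⟩! * 1/[1-q^1+ m ]

  1/⟨ zero  ⟩!⁻ = 1#
  1/⟨ suc m ⟩!⁻ = 1/⟨ m ⟩!⁻ * - (q ^ suc m * 1/[1-q^1+ m ])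

  1/⟨⟩!-inverse : ∀ m → 1/⟨ m ⟩! * ⟨ m ⟩! ≈ 1#
  1/⟨⟩!-inverse zero    = *-identityˡ _
  1/⟨⟩!-inverse (suc m) = trans (interchange _ _ _ _)
    (trans (*-cong (1/⟨⟩!-inverse m) (1/[1-q^1+]-inverse m)) (*-identityˡ _))

  -- From 1 - q⁻ᵐ = -q⁻ᵐ(1 - qᵐ), so that the inverses of the 1 - qᵐ suffice.
  1/[1-q⁻¹^1+]-inverse : ∀ m → - (q ^ suc m * 1/[1-q^1+ m ]) * (1# - q⁻¹ ^ suc m) ≈ 1#
  1/[1-q⁻¹^1+]-inverse m = begin
    - (q ^ suc m * r) * (1# - q⁻¹ ^ suc m)     ≈⟨ -‿distribˡ-* _ _ ⟨
    - (q ^ suc m * r * (1# - q⁻¹ ^ suc m))     ≈⟨ -‿cong (xy∙z≈y∙xz _ _ _) ⟩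
    - (r * (q ^ suc m * (1# - q⁻¹ ^ suc m)))   ≈⟨ -‿distribʳ-* _ _ ⟩
    r * - (q ^ suc m * (1# - q⁻¹ ^ suc m))     ≈⟨ *-congˡ (-‿cong (x[y-z]≈xy-xz _ _ _)) ⟩
    r * - (q ^ suc m * 1# - q ^ suc m * q⁻¹ ^ suc m)
      ≈⟨ *-congˡ (-‿cong (+-cong (*-identityʳ _) (-‿cong (trans (*-comm _ _) (q⁻¹^*q^ (suc m)))))) ⟩
    r * - (q ^ suc m - 1#)                     ≈⟨ *-congˡ (⁻¹-anti-homo‿- _ _) ⟩
    r * (1# - q ^ suc m)                       ≈⟨ 1/[1-q^1+]-inverse m ⟩
    1#                                         ∎
    where r = 1/[1-q^1+ m ]

  1/⟨⟩!⁻-inverse : ∀ m → 1/⟨ m ⟩!⁻ * ⟨ m ⟩!⁻ ≈ 1#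
  1/⟨⟩!⁻-inverse zero    = *-identityˡ _
  1/⟨⟩!⁻-inverse (suc m) = trans (interchange _ _ _ _)
    (trans (*-cong (1/⟨⟩!⁻-inverse m) (1/[1-q⁻¹^1+]-inverse m)) (*-identityˡ _))

  -- For a + b = N this is 1 / ∏ (1 - q^(c-a)), the product over 0 ≤ c ≤ N, c ≠ a:
  -- the Lagrange weight of the node q^a, scaled by q^(aN).
  node : ℕ → ℕ → Carrier
  node a b = 1/⟨ a ⟩!⁻ * 1/⟨ b ⟩!

  -- At y = qᶻ this is the interpolation functional applied to xᶻ. By the q-binomial theorem it
  -- equals the product of (1 - qᵐy)/(1 - qᵐ) over 1 ≤ m ≤ N; `nodeSum-suc` supplies one factor at a
  -- time.
  nodeSum : ℕ → Carrier → Carrier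
  nodeSum N y = Σ≤ N (λ a → node a (N ∸ a) * y ^ a)

  private
    -- The value 0 at the boundary is the convention 1/(q;q)₋₁ = 0, which keeps the recursion
    -- uniform at both ends of the range.
    lowerˡ lowerʳ : ℕ → ℕ → Carrier
    lowerˡ zero    b = 0#
    lowerˡ (suc a) b = node a b
    lowerʳ a zero    = 0#
    lowerʳ a (suc b) = node a b

  -- From 1 - q^(a+b) = (1 - q^b) + q^b (1 - q^a).
  node-pascal : ∀ a b → (1# - q ^ (a ℕ.+ b)) * node a b ≈ lowerʳ a b + - (q ^ (a ℕ.+ b)) * lowerˡ a b
  node-pascal a b = begin
    (1# - q ^ (a ℕ.+ b)) * node a b
      ≈⟨ *-congʳ split ⟩
    ((1# - q ^ b) + q ^ b * (1# - q ^ a)) * node a b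
      ≈⟨ distribʳ _ _ _ ⟩
    (1# - q ^ b) * node a b + q ^ b * (1# - q ^ a) * node a b
      ≈⟨ +-cong (stepʳ b) (stepˡ a) ⟩
    lowerʳ a b + - (q ^ (a ℕ.+ b)) * lowerˡ a b ∎
    where
    split : 1# - q ^ (a ℕ.+ b) ≈ (1# - q ^ b) + q ^ b * (1# - q ^ a)
    split = begin
      1# - q ^ (a ℕ.+ b)                  ≈⟨ [x-y]+[y-z]≈x-z _ (q ^ b) _ ⟨
      (1# - q ^ b) + (q ^ b - q ^ (a ℕ.+ b))
        ≈⟨ +-congˡ (+-cong (*-identityʳ _) (-‿cong (trans (*-comm _ _) (sym (^-homo-* q a b))))) ⟨
      (1# - q ^ b) + (q ^ b * 1# - q ^ b * q ^ a)  ≈⟨ +-congˡ (x[y-z]≈xy-xz _ _ _) ⟨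
      (1# - q ^ b) + q ^ b * (1# - q ^ a) ∎

    stepʳ : ∀ b → (1# - q ^ b) * node a b ≈ lowerʳ a b
    stepʳ zero    = trans (*-congʳ (-‿inverseʳ 1#)) (zeroˡ _)
    stepʳ (suc b) = begin
      (1# - q ^ suc b) * (1/⟨ a ⟩!⁻ * (1/⟨ b ⟩! * 1/[1-q^1+ b ]))  ≈⟨ *-congˡ (*-assoc _ _ _) ⟨
      (1# - q ^ suc b) * (node a b * 1/[1-q^1+ b ])                ≈⟨ x∙yz≈y∙zx _ _ _ ⟩
      node a b * (1/[1-q^1+ b ] * (1# - q ^ suc b))                ≈⟨ *-congˡ (1/[1-q^1+]-inverse b) ⟩
      node a b * 1#                                                ≈⟨ *-identityʳ _ ⟩
      node a b                                                     ∎

    stepˡ : ∀ a → q ^ b * (1# - q ^ a) * node a b ≈ - (q ^ (a ℕ.+ b)) * lowerˡ a b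
    stepˡ zero    = trans (*-congʳ (trans (*-congˡ (-‿inverseʳ 1#)) (zeroʳ _))) (trans (zeroˡ _) (sym (zeroʳ _)))
    stepˡ (suc a) = begin
      q ^ b * (1# - q ^ suc a) * ((1/⟨ a ⟩!⁻ * - (q ^ suc a * r)) * 1/⟨ b ⟩!)
        ≈⟨ *-congˡ (xy∙z≈y∙xz _ _ _) ⟩
      q ^ b * (1# - q ^ suc a) * (- (q ^ suc a * r) * node a b)
        ≈⟨ *-assoc _ _ _ ⟨
      q ^ b * (1# - q ^ suc a) * - (q ^ suc a * r) * node a b
        ≈⟨ *-congʳ (begin
          q ^ b * (1# - q ^ suc a) * - (q ^ suc a * r)     ≈⟨ -‿distribʳ-* _ _ ⟨
          - (q ^ b * (1# - q ^ suc a) * (q ^ suc a * r))   ≈⟨ -‿cong (*-cong (*-comm _ _) (*-comm _ _)) ⟩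
          - ((1# - q ^ suc a) * q ^ b * (r * q ^ suc a))   ≈⟨ -‿cong (interchange _ _ _ _) ⟩
          - ((1# - q ^ suc a) * r * (q ^ b * q ^ suc a))   ≈⟨ -‿cong (*-cong (trans (*-comm _ _) (1/[1-q^1+]-inverse a)) (trans (*-comm _ _) (sym (^-homo-* q (suc a) b)))) ⟩
          - (1# * q ^ (suc a ℕ.+ b))                       ≈⟨ -‿cong (*-identityˡ _) ⟩
          - (q ^ (suc a ℕ.+ b))                            ∎) ⟩
      - (q ^ (suc a ℕ.+ b)) * node a b ∎
      where r = 1/[1-q^1+ a ]

  -- `node-pascal` is summed against yᵃ. Lowering the second index gives `nodeSum N y`; lowering the
  -- first shifts the summation by one and gives a further factor `y`. The two boundary terms are 0.
  nodeSum-suc : ∀ N y → (1# - q ^ suc N) * nodeSum (suc N) y ≈ (1# - q ^ suc N * y) * nodeSum N y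
  nodeSum-suc N y = begin
    (1# - q ^ suc N) * nodeSum (suc N) y
      ≈⟨ Σ≤-distribˡ (suc N) _ (λ a → node a (suc N ∸ a) * y ^ a) ⟨
    Σ≤ (suc N) (λ a → (1# - q ^ suc N) * (node a (suc N ∸ a) * y ^ a))
      ≈⟨ Σ≤-cong (suc N) (λ a a≤ → begin
           (1# - q ^ suc N) * (node a (suc N ∸ a) * y ^ a)
             ≈⟨ *-assoc _ _ _ ⟨
           (1# - q ^ suc N) * node a (suc N ∸ a) * y ^ a
             ≈⟨ *-congʳ (≡.subst (λ M → (1# - q ^ M) * node a (suc N ∸ a) ≈ lowerʳ a (suc N ∸ a) + - (q ^ M) * lowerˡ a (suc N ∸ a))
                  (ℕ.m+[n∸m]≡n a≤) (node-pascal a (suc N ∸ a))) ⟩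
           (lowerʳ a (suc N ∸ a) + - (q ^ suc N) * lowerˡ a (suc N ∸ a)) * y ^ a
             ≈⟨ distribʳ _ _ _ ⟩
           lowerʳ a (suc N ∸ a) * y ^ a + - (q ^ suc N) * lowerˡ a (suc N ∸ a) * y ^ a
             ≈⟨ +-congˡ (*-assoc _ _ _) ⟩
           lowerʳ a (suc N ∸ a) * y ^ a + - (q ^ suc N) * (lowerˡ a (suc N ∸ a) * y ^ a) ∎) ⟩
    Σ≤ (suc N) (λ a → upper a + - (q ^ suc N) * lower a)
      ≈⟨ Σ≤-distrib-+ (suc N) upper (λ a → - (q ^ suc N) * lower a) ⟩
    Σ≤ (suc N) upper +
    Σ≤ (suc N) (λ a → - (q ^ suc N) * lower a)
      ≈⟨ +-cong Σupper (trans (Σ≤-distribˡ (suc N) _ lower) (*-congˡ Σlower)) ⟩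
    nodeSum N y + - (q ^ suc N) * (y * nodeSum N y)
      ≈⟨ +-cong (sym (*-identityˡ _)) (trans (sym (*-assoc _ _ _)) (*-congʳ (sym (-‿distribˡ-* _ _)))) ⟩
    1# * nodeSum N y + - (q ^ suc N * y) * nodeSum N y
      ≈⟨ distribʳ _ _ _ ⟨
    (1# - q ^ suc N * y) * nodeSum N y ∎
    where
    term upper lower : ℕ → Carrier
    term  a = node a (N ∸ a) * y ^ a
    upper a = lowerʳ a (suc N ∸ a) * y ^ a
    lower a = lowerˡ a (suc N ∸ a) * y ^ a

    Σupper : Σ≤ (suc N) upper ≈ nodeSum N y
    Σupper = begin
      Σ≤ (suc N) upper
        ≈⟨ Σ≤-last N upper ⟩
      Σ≤ N upper + lowerʳ (suc N) (N ∸ N) * y ^ suc N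
        ≈⟨ +-cong (Σ≤-cong N (λ a a≤N → *-congʳ {y ^ a} (reflexive (≡.cong (lowerʳ a) (ℕ.+-∸-assoc 1 a≤N)))))
                  (*-congʳ (reflexive (≡.cong (lowerʳ (suc N)) (ℕ.n∸n≡0 N)))) ⟩
      nodeSum N y + 0# * y ^ suc N
        ≈⟨ trans (+-congˡ (zeroˡ _)) (+-identityʳ _) ⟩
      nodeSum N y ∎

    Σlower : Σ≤ (suc N) lower ≈ y * nodeSum N y
    Σlower = begin
      0# * 1# + Σ≤ N (λ a → node a (N ∸ a) * (y * y ^ a))
        ≈⟨ +-cong (zeroˡ _) (Σ≤-cong N (λ a _ → x∙yz≈y∙xz (node a (N ∸ a)) y (y ^ a))) ⟩
      0# + Σ≤ N (λ a → y * (node a (N ∸ a) * y ^ a))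
        ≈⟨ trans (+-identityˡ _) (Σ≤-distribˡ N y term) ⟩
      y * nodeSum N y ∎

  nodeSum-suc′ : ∀ N y → nodeSum (suc N) y ≈ 1/[1-q^1+ N ] * ((1# - q ^ suc N * y) * nodeSum N y)
  nodeSum-suc′ N y = begin
    nodeSum (suc N) y                                             ≈⟨ *-identityˡ _ ⟨
    1# * nodeSum (suc N) y                                        ≈⟨ *-congʳ (1/[1-q^1+]-inverse N) ⟨
    1/[1-q^1+ N ] * (1# - q ^ suc N) * nodeSum (suc N) y          ≈⟨ *-assoc _ _ _ ⟩
    1/[1-q^1+ N ] * ((1# - q ^ suc N) * nodeSum (suc N) y)        ≈⟨ *-congˡ (nodeSum-suc N y) ⟩
    1/[1-q^1+ N ] * ((1# - q ^ suc N * y) * nodeSum N y)          ∎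

  nodeSum-1 : ∀ N → nodeSum N 1# ≈ 1#
  nodeSum-1 zero    = trans (+-identityʳ _) (trans (*-identityʳ _) (*-identityˡ _))
  nodeSum-1 (suc N) = begin
    nodeSum (suc N) 1#                                     ≈⟨ nodeSum-suc′ N 1# ⟩
    1/[1-q^1+ N ] * ((1# - q ^ suc N * 1#) * nodeSum N 1#) ≈⟨ *-congˡ (*-cong (+-congˡ (-‿cong (*-identityʳ _))) (nodeSum-1 N)) ⟩
    1/[1-q^1+ N ] * ((1# - q ^ suc N) * 1#)                ≈⟨ *-congˡ (*-identityʳ _) ⟩
    1/[1-q^1+ N ] * (1# - q ^ suc N)                       ≈⟨ 1/[1-q^1+]-inverse N ⟩
    1#                                                     ∎

  -- Among the factors 1 - qy, ..., 1 - qᴺy of the product formula, the one with exponent `suc m`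
  -- vanishes here.
  nodeSum-q⁻ : ∀ N m → m ℕ.< N → nodeSum N (q⁻¹ ^ suc m) ≈ 0#
  nodeSum-q⁻ (suc N) m (ℕ.s≤s m≤N) =
    trans (nodeSum-suc′ N (q⁻¹ ^ suc m)) (trans (*-congˡ (vanish (ℕ.m≤n⇒m<n∨m≡n m≤N))) (zeroʳ _))
    where
    vanish : m ℕ.< N ⊎ m ≡ N → (1# - q ^ suc N * q⁻¹ ^ suc m) * nodeSum N (q⁻¹ ^ suc m) ≈ 0#
    vanish (inj₁ m<N)    = trans (*-congˡ (nodeSum-q⁻ N m m<N)) (zeroʳ _)
    vanish (inj₂ ≡.refl) = trans (*-congʳ (trans (+-congˡ (-‿cong
      (trans (*-comm _ _) (q⁻¹^*q^ (suc m))))) (-‿inverseʳ 1#))) (zeroˡ _)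

  -- Interpolation of the constant term

  module _ (N : ℕ) where

    open GridSums R N

    nodes : ∀ {n} → Vec ℕ n → Carrier
    nodes []      = 1#
    nodes (a ∷ v) = node a (N ∸ a) * nodes v

    -- Weight and monomial are both products over the coordinates, so the grid sum splits into one
    -- `nodeSum` per coordinate, and a single zero among these suffices.
    Σgrid-monomial-suc : ∀ n z (d : Vec ℤ n) →
      Σgrid (suc n) (λ v → nodes v * q^ ((z ∷ d) ∙ v)) ≈
      nodeSum N (q^ z) * Σgrid n (λ v → nodes v * q^ (d ∙ v))
    Σgrid-monomial-suc n z d = begin
      Σ≤ N (λ a → Σgrid n (λ v → (node a (N ∸ a) * nodes v) * q^ (z ℤ.* + a ℤ.+ d ∙ v)))
        ≈⟨ Σ≤-cong N (λ a _ → Σgrid-cong n (λ v _ → trans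
             (*-congˡ (trans (q^-homo (z ℤ.* + a) (d ∙ v)) (*-congʳ (q^-*+ z a))))
             (interchange (node a (N ∸ a)) (nodes v) _ _))) ⟩
      Σ≤ N (λ a → Σgrid n (λ v → (node a (N ∸ a) * (q^ z) ^ a) * (nodes v * q^ (d ∙ v))))
        ≈⟨ Σ≤-cong N (λ a _ → Σgrid-distribˡ n (node a (N ∸ a) * (q^ z) ^ a) (λ v → nodes v * q^ (d ∙ v))) ⟩
      Σ≤ N (λ a → (node a (N ∸ a) * (q^ z) ^ a) * Σgrid n (λ v → nodes v * q^ (d ∙ v)))
        ≈⟨ Σ≤-distribʳ N _ (λ a → node a (N ∸ a) * (q^ z) ^ a) ⟩
      nodeSum N (q^ z) * Σgrid n (λ v → nodes v * q^ (d ∙ v)) ∎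

    Σgrid-monomial-0 : ∀ n → Σgrid n (λ v → nodes v * q^ (0ᵛ n ∙ v)) ≈ 1#
    Σgrid-monomial-0 zero    = *-identityˡ _
    Σgrid-monomial-0 (suc n) = trans (Σgrid-monomial-suc n (+ 0) (0ᵛ n))
      (trans (*-cong (nodeSum-1 N) (Σgrid-monomial-0 n)) (*-identityˡ _))

    Σgrid-monomial-negative : ∀ {n} {d : Vec ℤ n} → VecAny.Any (SmallNegative N) d →
      Σgrid n (λ v → nodes v * q^ (d ∙ v)) ≈ 0#
    Σgrid-monomial-negative {suc n} {z ∷ d} (here (m , ≡.refl , m<N)) =
      trans (Σgrid-monomial-suc n z d) (trans (*-congʳ (nodeSum-q⁻ N m m<N)) (zeroˡ _))
    Σgrid-monomial-negative {suc n} {z ∷ d} (there neg) =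
      trans (Σgrid-monomial-suc n z d) (trans (*-congˡ (Σgrid-monomial-negative neg)) (zeroʳ _))

  module _ {n : ℕ} where

    open LaurentPolynomials rawRing n
    open RawRing laurentRing using () renaming (_+_ to _+ᴸ_; _*_ to _*ᴸ_; -_ to -ᴸ_; 1# to 1ᴸ)
    open RawSemiringDefinitions (RawRing.rawSemiring laurentRing) using () renaming (_^_ to _^ᴸ_)
    open RingOperations laurentRing using () renaming (∏ to ∏ᴸ; pochhammer to pochhammerᴸ)
    open LaurentSupport R n

    -- The value at xᵢ = q^(vᵢ).
    eval : Vec ℕ n → Laurent → Carrier
    eval v f = ∑ f (λ (a , d) → a * q^ (d ∙ v))

    -- Both sides are linear in f; on a monomial of degree 0 with a nonzero exponent, some
    -- exponent is negative and the sum over the corresponding coordinate vanishes.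
    ct-interpolation : ∀ N {b f} → (∀ i → b i ℕ.≤ N) → SupportedIn (+ 0) b f →
      ct f ≈ GridSums.Σgrid R N n (λ v → nodes N v * eval v f)
    ct-interpolation N {f = []} b≤N [] = sym (Σgrid-zero n (λ v _ → zeroʳ _))
      where open GridSums R N
    ct-interpolation N {b} {f = (a , d) ∷ f} b≤N (sd ∷ sf) = begin
      ct ((a , d) ∷ f)
        ≈⟨ coefficient-∷ (supported⇒zero⊎smallNegative N {d = d} b≤N sd) ⟩
      a * Σgrid n (λ v → nodes N v * q^ (d ∙ v)) + ct f
        ≈⟨ +-cong (sym (Σgrid-distribˡ n a (λ v → nodes N v * q^ (d ∙ v)))) (ct-interpolation N b≤N sf) ⟩
      Σgrid n (λ v → a * (nodes N v * q^ (d ∙ v))) + Σgrid n (λ v → nodes N v * eval v f)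
        ≈⟨ Σgrid-distrib-+ n (λ v → a * (nodes N v * q^ (d ∙ v))) (λ v → nodes N v * eval v f) ⟨
      Σgrid n (λ v → a * (nodes N v * q^ (d ∙ v)) + nodes N v * eval v f)
        ≈⟨ Σgrid-cong n (λ v _ → trans (+-congʳ (x∙yz≈y∙xz _ _ _)) (sym (distribˡ _ _ _))) ⟩
      Σgrid n (λ v → nodes N v * eval v ((a , d) ∷ f)) ∎
      where
      open GridSums R N

      nonzero : ∀ {m} → ¬ VecAny.Any (SmallNegative N) (0ᵛ m)
      nonzero {suc m} (here (_ , () , _))
      nonzero {suc m} (there neg) = nonzero neg

      coefficient-∷ : d ≡ 0ᵛ n ⊎ VecAny.Any (SmallNegative N) d →
        ct ((a , d) ∷ f) ≈ a * Σgrid n (λ v → nodes N v * q^ (d ∙ v)) + ct f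
      coefficient-∷ (inj₁ ≡.refl) rewrite dec-true (Vec.≡-dec ℤ._≟_ d d) ≡.refl =
        +-congʳ (sym (trans (*-congˡ (Σgrid-monomial-0 N n)) (*-identityʳ a)))
      coefficient-∷ (inj₂ neg) rewrite dec-false (Vec.≡-dec ℤ._≟_ d (0ᵛ n)) (λ d≡0 → nonzero (≡.subst (VecAny.Any (SmallNegative N)) d≡0 neg)) =
        sym (trans (+-congʳ (trans (*-congˡ (Σgrid-monomial-negative N neg)) (zeroʳ a))) (+-identityˡ _))

    module _ (v : Vec ℕ n) where

      eval-+ : ∀ f g → eval v (f +ᴸ g) ≈ eval v f + eval v g
      eval-+ f g = ∑-++ f g _

      eval-* : ∀ f g → eval v (f *ᴸ g) ≈ eval v f * eval v g
      eval-* f g = begin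
        eval v (f *ᴸ g)
          ≈⟨ ∑-cartesianProductWith _ f g _ ⟩
        ∑ f (λ (a , d) → ∑ g (λ (b , e) → (a * b) * q^ (Vec.zipWith ℤ._+_ d e ∙ v)))
          ≈⟨ ∑-cong f (λ (a , d) → trans
               (∑-cong g (λ (b , e) → trans
                 (*-congˡ (trans (reflexive (≡.cong q^_ (∙-+ d e v))) (q^-homo (d ∙ v) (e ∙ v))))
                 (interchange _ _ _ _)))
               (∑-distribˡ (a * q^ (d ∙ v)) g (λ (b , e) → b * q^ (e ∙ v)))) ⟩
        ∑ f (λ (a , d) → (a * q^ (d ∙ v)) * eval v g)
          ≈⟨ ∑-distribʳ (eval v g) f (λ (a , d) → a * q^ (d ∙ v)) ⟩
        eval v f * eval v g ∎

      eval-neg : ∀ f → eval v (-ᴸ f) ≈ - eval v f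
      eval-neg []            = sym -0#≈0#
      eval-neg ((a , d) ∷ f) = trans (+-cong (sym (-‿distribˡ-* _ _)) (eval-neg f)) (-‿+-comm _ _)

      eval-constant : ∀ a → eval v (constant a) ≈ a
      eval-constant a = trans (+-identityʳ _)
        (trans (*-congˡ (reflexive (≡.cong q^_ (∙-0ᵛ v)))) (*-identityʳ a))

      eval-^ : ∀ f k → eval v (f ^ᴸ k) ≈ eval v f ^ k
      eval-^ f zero    = eval-constant 1#
      eval-^ f (suc k) = trans (eval-* f (f ^ᴸ k)) (*-congˡ (eval-^ f k))

      eval-∏ : ∀ {A : Set} (xs : List A) F → eval v (∏ᴸ xs F) ≈ ∏ xs (λ x → eval v (F x))
      eval-∏ []       F = eval-constant 1#
      eval-∏ (x ∷ xs) F = trans (eval-* (F x) (∏ᴸ xs F)) (*-congˡ (eval-∏ xs F))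

      eval-pochhammer : ∀ a f k → eval v (pochhammerᴸ (constant a) f k) ≈ pochhammer a (eval v f) k
      eval-pochhammer a f zero    = eval-constant 1#
      eval-pochhammer a f (suc k) = begin
        eval v (pochhammerᴸ (constant a) f k *ᴸ (1ᴸ +ᴸ -ᴸ (constant a ^ᴸ k *ᴸ f)))
          ≈⟨ eval-* (pochhammerᴸ (constant a) f k) _ ⟩
        eval v (pochhammerᴸ (constant a) f k) * eval v (1ᴸ +ᴸ -ᴸ (constant a ^ᴸ k *ᴸ f))
          ≈⟨ *-cong (eval-pochhammer a f k)
               (trans (eval-+ 1ᴸ (-ᴸ (constant a ^ᴸ k *ᴸ f)))
                 (+-cong (eval-constant 1#) (trans (eval-neg (constant a ^ᴸ k *ᴸ f))
                   (-‿cong (trans (eval-* (constant a ^ᴸ k) f)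
                     (*-congʳ (trans (eval-^ (constant a) k) (^-congˡ k (eval-constant a))))))))) ⟩
        pochhammer a (eval v f) (suc k) ∎

      eval-unit : ∀ i z → eval v ((1# , 0ᵛ n Vec.[ i ]≔ z) ∷ []) ≈ q^ (z ℤ.* + Vec.lookup v i)
      eval-unit i z = trans (+-identityʳ _) (trans (*-identityˡ _) (reflexive (≡.cong q^_ (∙-≔ i z v))))

      eval-x : ∀ i → eval v (x i) ≈ q^ (+ Vec.lookup v i)
      eval-x i = trans (eval-unit i (+ 1)) (reflexive (≡.cong q^_ (ℤ.*-identityˡ (+ Vec.lookup v i))))

      eval-x⁻¹ : ∀ i → eval v (x⁻¹ i) ≈ q^ (ℤ.- + Vec.lookup v i)
      eval-x⁻¹ i = trans (eval-unit i (ℤ.- + 1)) (reflexive (≡.cong q^_ (ℤ.-1*i≡-i (+ Vec.lookup v i))))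

      eval-x/x : ∀ i j → eval v (x i *ᴸ x⁻¹ j) ≈ q^ (Vec.lookup v i ℤ.⊖ Vec.lookup v j)
      eval-x/x i j = begin
        eval v (x i *ᴸ x⁻¹ j)                              ≈⟨ eval-* (x i) (x⁻¹ j) ⟩
        eval v (x i) * eval v (x⁻¹ j)                      ≈⟨ *-cong (eval-x i) (eval-x⁻¹ j) ⟩
        q^ (+ a) * q^ (ℤ.- + b)                            ≈⟨ q^-homo (+ a) (ℤ.- + b) ⟨
        q^ (+ a ℤ.+ ℤ.- + b)                               ≡⟨ ≡.cong q^_ (ℤ.[+m]-[+n]≡m⊖n a b) ⟩
        q^ (a ℤ.⊖ b)                                       ∎
        where
        a = Vec.lookup v i
        b = Vec.lookup v j

      eval-x\x : ∀ i j → eval v (x⁻¹ i *ᴸ x j) ≈ q^ (Vec.lookup v j ℤ.⊖ Vec.lookup v i)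
      eval-x\x i j = begin
        eval v (x⁻¹ i *ᴸ x j)          ≈⟨ eval-* (x⁻¹ i) (x j) ⟩
        eval v (x⁻¹ i) * eval v (x j)  ≈⟨ *-comm _ _ ⟩
        eval v (x j) * eval v (x⁻¹ i)  ≈⟨ eval-* (x j) (x⁻¹ i) ⟨
        eval v (x j *ᴸ x⁻¹ i)          ≈⟨ eval-x/x j i ⟩
        q^ (Vec.lookup v j ℤ.⊖ Vec.lookup v i) ∎

  -- Values of the weights at the grid points

  pochhammer-cong : ∀ a {y z} k → y ≈ z → pochhammer a y k ≈ pochhammer a z k
  pochhammer-cong a zero    y≈z = refl
  pochhammer-cong a (suc k) y≈z = *-cong (pochhammer-cong a k y≈z) (+-congˡ (-‿cong (*-congˡ y≈z)))

  -- A function of lists, so that `↭` can act on the points.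
  pairProduct : (ℕ → ℕ → Carrier) → List ℕ → Carrier
  pairProduct h []       = 1#
  pairProduct h (a ∷ as) = ∏ as (h a) * pairProduct h as

  ∏-lookup : ∀ {n} (h : ℕ → Carrier) (v : Vec ℕ n) →
    ∏ (List.allFin n) (λ i → h (Vec.lookup v i)) ≈ ∏ (Vec.toList v) h
  ∏-lookup h []      = refl
  ∏-lookup {suc n} h (a ∷ v) = begin
    ∏ (List.allFin (suc n)) (λ i → h (Vec.lookup (a ∷ v) i))
      ≡⟨ ≡.cong (λ is → ∏ is (λ i → h (Vec.lookup (a ∷ v) i))) (allFin-suc n) ⟩
    h a * ∏ (List.map Fin.suc (List.allFin n)) (λ i → h (Vec.lookup (a ∷ v) i))
      ≈⟨ *-congˡ (trans (∏-map Fin.suc (List.allFin n) _) (∏-lookup h v)) ⟩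
    h a * ∏ (Vec.toList v) h ∎

  ∏-increasingPairs : ∀ {n} (h : ℕ → ℕ → Carrier) (v : Vec ℕ n) →
    ∏ (increasingPairs n) (λ (i , j) → h (Vec.lookup v i) (Vec.lookup v j)) ≈ pairProduct h (Vec.toList v)
  ∏-increasingPairs         h []      = refl
  ∏-increasingPairs {suc n} h (a ∷ v) =
    trans (∏-increasingPairs-suc n _) (*-cong (∏-lookup (h a) v) (∏-increasingPairs h v))

  weightFactor symmetricFactor : ℕ → ℕ → ℕ → Carrier
  weightFactor    k a b = pochhammer q (q^ (a ℤ.⊖ b)) k * pochhammer q (q * q^ (b ℤ.⊖ a)) k
  symmetricFactor k a b = pochhammer q (q^ (a ℤ.⊖ b)) k * pochhammer q (q^ (b ℤ.⊖ a)) k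

  module _ {n : ℕ} (v : Vec ℕ n) (k : ℕ) where

    open LaurentPolynomials rawRing n
    open RawRing laurentRing using () renaming (_*_ to _*ᴸ_)
    open RingOperations laurentRing using () renaming (pochhammer to pochhammerᴸ)

    eval-weight : eval v (weight q k) ≈ pairProduct (weightFactor k) (Vec.toList v)
    eval-weight = begin
      eval v (weight q k)
        ≈⟨ eval-∏ v (increasingPairs n) _ ⟩
      ∏ (increasingPairs n) (λ (i , j) → eval v
        (pochhammerᴸ (constant q) (x i *ᴸ x⁻¹ j) k *ᴸ pochhammerᴸ (constant q) (constant q *ᴸ (x⁻¹ i *ᴸ x j)) k))
        ≈⟨ ∏-cong (increasingPairs n) (λ (i , j) → trans
             (eval-* v (pochhammerᴸ (constant q) (x i *ᴸ x⁻¹ j) k) _)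
             (*-cong (trans (eval-pochhammer v q (x i *ᴸ x⁻¹ j) k) (pochhammer-cong q k (eval-x/x v i j)))
                     (trans (eval-pochhammer v q (constant q *ᴸ (x⁻¹ i *ᴸ x j)) k)
                       (pochhammer-cong q k (trans (eval-* v (constant q) (x⁻¹ i *ᴸ x j)) (*-cong (eval-constant v q) (eval-x\x v i j))))))) ⟩
      ∏ (increasingPairs n) (λ (i , j) → weightFactor k (Vec.lookup v i) (Vec.lookup v j))
        ≈⟨ ∏-increasingPairs (weightFactor k) v ⟩
      pairProduct (weightFactor k) (Vec.toList v) ∎

    eval-symmetricWeight : eval v (symmetricWeight q k) ≈ pairProduct (symmetricFactor k) (Vec.toList v)
    eval-symmetricWeight = begin
      eval v (symmetricWeight q k)
        ≈⟨ eval-∏ v (increasingPairs n) _ ⟩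
      ∏ (increasingPairs n) (λ (i , j) → eval v
        (pochhammerᴸ (constant q) (x i *ᴸ x⁻¹ j) k *ᴸ pochhammerᴸ (constant q) (x⁻¹ i *ᴸ x j) k))
        ≈⟨ ∏-cong (increasingPairs n) (λ (i , j) → trans
             (eval-* v (pochhammerᴸ (constant q) (x i *ᴸ x⁻¹ j) k) _)
             (*-cong (trans (eval-pochhammer v q (x i *ᴸ x⁻¹ j) k) (pochhammer-cong q k (eval-x/x v i j)))
                     (trans (eval-pochhammer v q (x⁻¹ i *ᴸ x j) k) (pochhammer-cong q k (eval-x\x v i j))))) ⟩
      ∏ (increasingPairs n) (λ (i , j) → symmetricFactor k (Vec.lookup v i) (Vec.lookup v j))
        ≈⟨ ∏-increasingPairs (symmetricFactor k) v ⟩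
      pairProduct (symmetricFactor k) (Vec.toList v) ∎

  -- Zeros of the weights

  pochhammer-vanish : ∀ z r k → r ℕ.< k → q ^ r * z ≈ 1# → pochhammer q z k ≈ 0#
  pochhammer-vanish z r (suc k) (ℕ.s≤s r≤k) eq with ℕ.m≤n⇒m<n∨m≡n r≤k
  ... | inj₁ r<k    = trans (*-congʳ (pochhammer-vanish z r k r<k eq)) (zeroˡ _)
  ... | inj₂ ≡.refl = trans (*-congˡ (trans (+-congˡ (-‿cong eq)) (-‿inverseʳ 1#))) (zeroʳ _)

  q^-⊖-≤ : ∀ a r → q^ (a ℤ.⊖ (a ℕ.+ r)) ≈ q⁻¹ ^ r
  q^-⊖-≤ a r = trans (reflexive (≡.cong q^_
    (≡.trans (ℤ.⊖-≤ (ℕ.m≤m+n a r)) (≡.cong (λ m → ℤ.- + m) (ℕ.m+n∸m≡n a r))))) (q^-neg-^ r)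

  q^-⊖-≥ : ∀ a r → q^ ((a ℕ.+ r) ℤ.⊖ a) ≈ q ^ r
  q^-⊖-≥ a r = reflexive (≡.cong q^_
    (≡.trans (ℤ.⊖-≥ (ℕ.m≤m+n a r)) (≡.cong +_ (ℕ.m+n∸m≡n a r))))

  pochhammer-⊖-vanish : ∀ k a r → r ℕ.< k → pochhammer q (q^ (a ℤ.⊖ (a ℕ.+ r))) k ≈ 0#
  pochhammer-⊖-vanish k a r r<k = pochhammer-vanish _ r k r<k
    (trans (*-congˡ (q^-⊖-≤ a r)) (trans (*-comm _ _) (q⁻¹^*q^ r)))

  pochhammer-q⊖-vanish : ∀ k a r → r ℕ.< k → pochhammer q (q * q^ (a ℤ.⊖ (a ℕ.+ suc r))) k ≈ 0#
  pochhammer-q⊖-vanish k a r r<k = pochhammer-vanish _ r k r<k (begin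
    q ^ r * (q * q^ (a ℤ.⊖ (a ℕ.+ suc r)))  ≈⟨ *-congˡ (*-congˡ (q^-⊖-≤ a (suc r))) ⟩
    q ^ r * (q * q⁻¹ ^ suc r)               ≈⟨ x∙yz≈z∙yx _ _ _ ⟩
    q⁻¹ ^ suc r * (q * q ^ r)               ≈⟨ q⁻¹^*q^ (suc r) ⟩
    1#                                      ∎)

  private
    ≤⇒+ : ∀ {a b} → a ℕ.≤ b → ∃[ r ] b ≡ a ℕ.+ r
    ≤⇒+ {a} {b} a≤b = b ∸ a , ≡.sym (ℕ.m+[n∸m]≡n a≤b)

  -- Equality in the ring is not assumed decidable, so the cases are distinguished on the exponents:
  -- for `b = a + r` with `r < k` the first Pochhammer symbol contains the factor 1 - qʳq⁻ʳ.
  weightFactor-vanish : ∀ k a b → OrderedApart k a b ⊎ weightFactor k a b ≈ 0#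
  weightFactor-vanish k a b with a ℕ.≤? b
  ... | yes a≤b with r , ≡.refl ← ≤⇒+ a≤b with k ℕ.≤? r
  ...   | yes k≤r = inj₁ (inj₁ (ℕ.+-monoʳ-≤ a k≤r))
  ...   | no  k≰r = inj₂ (trans (*-congʳ (pochhammer-⊖-vanish k a r (ℕ.≰⇒> k≰r))) (zeroˡ _))
  -- Here a = b + 1 + r. The additional `q` absorbs the 1, so the factor of index `r` vanishes for
  -- `r < k`, and otherwise `a` exceeds `b + k` strictly.
  weightFactor-vanish k a b | no a≰b with r , ≡.refl ← ≤⇒+ (ℕ.≰⇒> a≰b) with k ℕ.≤? r
  ...   | yes k≤r = inj₁ (inj₂ (ℕ.s≤s (ℕ.+-monoʳ-≤ b k≤r)))
  ...   | no  k≰r = inj₂ (trans (*-congˡ (≡.subst (λ a → pochhammer q (q * q^ (b ℤ.⊖ a)) k ≈ 0#)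
                      (ℕ.+-suc b r) (pochhammer-q⊖-vanish k b r (ℕ.≰⇒> k≰r)))) (zeroʳ _))

  symmetricFactor-vanish : ∀ k a b → Apart k a b ⊎ symmetricFactor k a b ≈ 0#
  symmetricFactor-vanish k a b with ℕ.≤-total a b
  ... | inj₁ a≤b with r , ≡.refl ← ≤⇒+ a≤b with k ℕ.≤? r
  ...   | yes k≤r = inj₁ (inj₁ (ℕ.+-monoʳ-≤ a k≤r))
  ...   | no  k≰r = inj₂ (trans (*-congʳ (pochhammer-⊖-vanish k a r (ℕ.≰⇒> k≰r))) (zeroˡ _))
  symmetricFactor-vanish k a b | inj₂ b≤a with r , ≡.refl ← ≤⇒+ b≤a with k ℕ.≤? r
  ...   | yes k≤r = inj₁ (inj₂ (ℕ.+-monoʳ-≤ b k≤r))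
  ...   | no  k≰r = inj₂ (trans (*-congˡ (pochhammer-⊖-vanish k b r (ℕ.≰⇒> k≰r))) (zeroʳ _))

  ∏-vanish : ∀ {P : ℕ → Set} {h} → (∀ b → P b ⊎ h b ≈ 0#) → ∀ bs → All P bs ⊎ ∏ bs h ≈ 0#
  ∏-vanish P⊎0 []       = inj₁ []
  ∏-vanish P⊎0 (b ∷ bs) with P⊎0 b | ∏-vanish P⊎0 bs
  ... | inj₂ h≈0 | _        = inj₂ (trans (*-congʳ h≈0) (zeroˡ _))
  ... | inj₁ _   | inj₂ h≈0 = inj₂ (trans (*-congˡ h≈0) (zeroʳ _))
  ... | inj₁ p   | inj₁ ps  = inj₁ (p ∷ ps)

  pairProduct-vanish : ∀ {P : ℕ → ℕ → Set} {h} → (∀ a b → P a b ⊎ h a b ≈ 0#) →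
    ∀ as → AllPairs P as ⊎ pairProduct h as ≈ 0#
  pairProduct-vanish P⊎0 []       = inj₁ []
  pairProduct-vanish P⊎0 (a ∷ as) with ∏-vanish (P⊎0 a) as | pairProduct-vanish P⊎0 as
  ... | inj₂ h≈0 | _        = inj₂ (trans (*-congʳ h≈0) (zeroˡ _))
  ... | inj₁ _   | inj₂ h≈0 = inj₂ (trans (*-congˡ h≈0) (zeroʳ _))
  ... | inj₁ p   | inj₁ ps  = inj₁ (p ∷ ps)

  ∏-↭ : ∀ {as bs : List ℕ} h → as ↭ bs → ∏ as h ≈ ∏ bs h
  ∏-↭ h ↭.refl         = refl
  ∏-↭ h (↭.prep a p)   = *-congˡ (∏-↭ h p)
  ∏-↭ h (↭.swap a b p) = trans (x∙yz≈y∙xz _ _ _) (*-congˡ (*-congˡ (∏-↭ h p)))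
  ∏-↭ h (↭.trans p p′) = trans (∏-↭ h p) (∏-↭ h p′)

  -- Only `swap` reverses a pair, and there the symmetry of `h` enters.
  pairProduct-↭ : ∀ {as bs h} → (∀ a b → h a b ≈ h b a) → as ↭ bs → pairProduct h as ≈ pairProduct h bs
  pairProduct-↭ h-sym ↭.refl         = refl
  pairProduct-↭ {h = h} h-sym (↭.prep a p) = *-cong (∏-↭ (h a) p) (pairProduct-↭ h-sym p)
  pairProduct-↭ {h = h} h-sym (↭.swap {as} {bs} a b p) = begin
    (h a b * ∏ as (h a)) * (∏ as (h b) * pairProduct h as)
      ≈⟨ *-cong (*-cong (h-sym a b) (∏-↭ (h a) p)) (*-cong (∏-↭ (h b) p) (pairProduct-↭ h-sym p)) ⟩
    (h b a * ∏ bs (h a)) * (∏ bs (h b) * pairProduct h bs)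
      ≈⟨ interchange _ _ _ _ ⟩
    (h b a * ∏ bs (h b)) * (∏ bs (h a) * pairProduct h bs) ∎
  pairProduct-↭ h-sym (↭.trans p p′) = trans (pairProduct-↭ h-sym p) (pairProduct-↭ h-sym p′)

  -- Telescoping along the progression

  -- The exponents of q⁻¹ in the symbol descend from k + M to M + 1, so its last factor is the one
  -- that extends `⟨ M ⟩!⁻`, and the induction continues with `suc M`.
  ⟨⟩!⁻-extend : ∀ k M → ⟨ M ⟩!⁻ * pochhammer q (q⁻¹ ^ (k ℕ.+ M)) k ≈ ⟨ k ℕ.+ M ⟩!⁻
  ⟨⟩!⁻-extend zero    M = *-identityʳ _
  ⟨⟩!⁻-extend (suc k) M = begin
    ⟨ M ⟩!⁻ * (pochhammer q z k * (1# - q ^ k * z))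
      ≈⟨ *-congˡ (*-congˡ (+-congˡ (-‿cong cancel))) ⟩
    ⟨ M ⟩!⁻ * (pochhammer q z k * (1# - q⁻¹ ^ suc M))
      ≈⟨ x∙yz≈xz∙y _ _ _ ⟩
    ⟨ suc M ⟩!⁻ * pochhammer q z k
      ≡⟨ ≡.cong (λ m → ⟨ suc M ⟩!⁻ * pochhammer q (q⁻¹ ^ m) k) (ℕ.+-suc k M) ⟨
    ⟨ suc M ⟩!⁻ * pochhammer q (q⁻¹ ^ (k ℕ.+ suc M)) k
      ≈⟨ ⟨⟩!⁻-extend k (suc M) ⟩
    ⟨ k ℕ.+ suc M ⟩!⁻
      ≡⟨ ≡.cong ⟨_⟩!⁻ (ℕ.+-suc k M) ⟩
    ⟨ suc k ℕ.+ M ⟩!⁻ ∎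
    where
    z = q⁻¹ ^ (suc k ℕ.+ M)

    cancel : q ^ k * z ≈ q⁻¹ ^ suc M
    cancel = begin
      q ^ k * q⁻¹ ^ (suc k ℕ.+ M)         ≡⟨ ≡.cong (λ m → q ^ k * q⁻¹ ^ m) (ℕ.+-suc k M) ⟨
      q ^ k * q⁻¹ ^ (k ℕ.+ suc M)         ≈⟨ *-congˡ (^-homo-* q⁻¹ k (suc M)) ⟩
      q ^ k * (q⁻¹ ^ k * q⁻¹ ^ suc M)     ≈⟨ x∙yz≈yx∙z _ _ _ ⟩
      (q⁻¹ ^ k * q ^ k) * q⁻¹ ^ suc M     ≈⟨ *-congʳ (q⁻¹^*q^ k) ⟩
      1# * q⁻¹ ^ suc M                    ≈⟨ *-identityˡ _ ⟩
      q⁻¹ ^ suc M                         ∎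

  ⟨⟩!-extend : ∀ k M → ⟨ M ⟩! * pochhammer q (q ^ suc M) k ≈ ⟨ k ℕ.+ M ⟩!
  ⟨⟩!-extend zero    M = *-identityʳ _
  ⟨⟩!-extend (suc k) M = begin
    ⟨ M ⟩! * (pochhammer q (q ^ suc M) k * (1# - q ^ k * q ^ suc M))
      ≈⟨ *-assoc _ _ _ ⟨
    ⟨ M ⟩! * pochhammer q (q ^ suc M) k * (1# - q ^ k * q ^ suc M)
      ≈⟨ *-cong (⟨⟩!-extend k M) (+-congˡ (-‿cong (trans (sym (^-homo-* q k (suc M)))
           (reflexive (≡.cong (q ^_) (ℕ.+-suc k M)))))) ⟩
    ⟨ k ℕ.+ M ⟩! * (1# - q ^ suc (k ℕ.+ M)) ∎

  pochhammer-q≈⟨⟩! : ∀ k → pochhammer q q k ≈ ⟨ k ⟩!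
  pochhammer-q≈⟨⟩! zero    = refl
  pochhammer-q≈⟨⟩! (suc k) = *-cong (pochhammer-q≈⟨⟩! k) (+-congˡ (-‿cong (*-comm _ _)))

  -- `h` at distance (d + 1)k from `a` plays the role of the ratio F(d + 1)/F(d); multiplied out,
  -- the statement needs no division.
  ∏-telescope : ∀ k (F h : ℕ → Carrier) a →
    (∀ d → F d * h (suc d ℕ.* k ℕ.+ a) ≈ F (suc d)) →
    ∀ d D → F d * ∏ (Vec.toList (progression k (suc d ℕ.* k ℕ.+ a) D)) h ≈ F (d ℕ.+ D)
  ∏-telescope k F h a step d zero    = trans (*-identityʳ _) (reflexive (≡.cong F (≡.sym (ℕ.+-identityʳ d))))
  ∏-telescope k F h a step d (suc D) = begin
    F d * (h b * ∏ (Vec.toList (progression k (k ℕ.+ b) D)) h)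
      ≈⟨ *-assoc _ _ _ ⟨
    F d * h b * ∏ (Vec.toList (progression k (k ℕ.+ b) D)) h
      ≈⟨ *-cong (step d) (reflexive (≡.cong (λ m → ∏ (Vec.toList (progression k m D)) h) (≡.sym (ℕ.+-assoc k _ a)))) ⟩
    F (suc d) * ∏ (Vec.toList (progression k (suc (suc d) ℕ.* k ℕ.+ a) D)) h
      ≈⟨ ∏-telescope k F h a step (suc d) D ⟩
    F (suc d ℕ.+ D)
      ≡⟨ ≡.cong F (ℕ.+-suc d D) ⟨
    F (d ℕ.+ suc D) ∎
    where b = suc d ℕ.* k ℕ.+ a

  -- With M = (d + 1)k, the symbol starting at q⁻ᴹ carries `⟨ d ℕ.* k ⟩!⁻` to `⟨ M ⟩!⁻`, and the one
  -- starting at qᴹ⁺¹ carries `⟨ M ⟩!` to `⟨ k ℕ.+ M ⟩!`.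
  weightFactor-step : ∀ k a d →
    ⟨ d ℕ.* k ⟩!⁻ * ⟨ suc d ℕ.* k ⟩! * weightFactor k a (suc d ℕ.* k ℕ.+ a) ≈
    ⟨ suc d ℕ.* k ⟩!⁻ * ⟨ suc (suc d) ℕ.* k ⟩!
  weightFactor-step k a d = begin
    ⟨ d ℕ.* k ⟩!⁻ * ⟨ M ⟩! * weightFactor k a (M ℕ.+ a)
      ≡⟨ ≡.cong (λ b → ⟨ d ℕ.* k ⟩!⁻ * ⟨ M ⟩! * weightFactor k a b) (ℕ.+-comm M a) ⟩
    ⟨ d ℕ.* k ⟩!⁻ * ⟨ M ⟩! * weightFactor k a (a ℕ.+ M)
      ≈⟨ *-congˡ (*-cong (pochhammer-cong q k (q^-⊖-≤ a M)) (pochhammer-cong q k (*-congˡ (q^-⊖-≥ a M)))) ⟩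
    ⟨ d ℕ.* k ⟩!⁻ * ⟨ M ⟩! * (pochhammer q (q⁻¹ ^ M) k * pochhammer q (q ^ suc M) k)
      ≈⟨ interchange _ _ _ _ ⟩
    (⟨ d ℕ.* k ⟩!⁻ * pochhammer q (q⁻¹ ^ M) k) * (⟨ M ⟩! * pochhammer q (q ^ suc M) k)
      ≈⟨ *-cong (⟨⟩!⁻-extend k (d ℕ.* k)) (⟨⟩!-extend k M) ⟩
    ⟨ M ⟩!⁻ * ⟨ k ℕ.+ M ⟩! ∎
    where M = suc d ℕ.* k

  -- Lacking the additional `q`, the second symbol starts at the power of q given by the distance
  -- itself and not at the next one, so the factorial that it extends stops one short. This is the
  -- source of the `∸ 1` in the second family of q-binomials.
  symmetricFactor-step : ∀ k a d → let k′ = suc k in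
    ⟨ d ℕ.* k′ ⟩!⁻ * ⟨ suc d ℕ.* k′ ∸ 1 ⟩! * symmetricFactor k′ a (suc d ℕ.* k′ ℕ.+ a) ≈
    ⟨ suc d ℕ.* k′ ⟩!⁻ * ⟨ suc (suc d) ℕ.* k′ ∸ 1 ⟩!
  symmetricFactor-step k a d = begin
    ⟨ d ℕ.* k′ ⟩!⁻ * ⟨ M ⟩! * symmetricFactor k′ a (suc M ℕ.+ a)
      ≡⟨ ≡.cong (λ b → ⟨ d ℕ.* k′ ⟩!⁻ * ⟨ M ⟩! * symmetricFactor k′ a b) (ℕ.+-comm (suc M) a) ⟩
    ⟨ d ℕ.* k′ ⟩!⁻ * ⟨ M ⟩! * symmetricFactor k′ a (a ℕ.+ suc M)
      ≈⟨ *-congˡ (*-cong (pochhammer-cong q k′ (q^-⊖-≤ a (suc M))) (pochhammer-cong q k′ (q^-⊖-≥ a (suc M)))) ⟩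
    ⟨ d ℕ.* k′ ⟩!⁻ * ⟨ M ⟩! * (pochhammer q (q⁻¹ ^ suc M) k′ * pochhammer q (q ^ suc M) k′)
      ≈⟨ interchange _ _ _ _ ⟩
    (⟨ d ℕ.* k′ ⟩!⁻ * pochhammer q (q⁻¹ ^ suc M) k′) * (⟨ M ⟩! * pochhammer q (q ^ suc M) k′)
      ≈⟨ *-cong (⟨⟩!⁻-extend k′ (d ℕ.* k′)) (⟨⟩!-extend k′ M) ⟩
    ⟨ suc M ⟩!⁻ * ⟨ k′ ℕ.+ M ⟩!
      ≡⟨ ≡.cong (λ m → ⟨ suc M ⟩!⁻ * ⟨ m ⟩!) (ℕ.+-suc k M) ⟨
    ⟨ suc M ⟩!⁻ * ⟨ k ℕ.+ suc M ⟩! ∎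
    where
    k′ = suc k
    M  = k ℕ.+ d ℕ.* k′

  pairProduct-progression : ∀ k h (row : ℕ → Carrier) →
    (∀ a D → ∏ (Vec.toList (progression k (k ℕ.+ a) D)) (h a) ≈ row D) →
    ∀ a n → pairProduct h (Vec.toList (progression k a n)) ≈ ∏< n row
  pairProduct-progression k h row eq a zero    = refl
  pairProduct-progression k h row eq a (suc n) =
    *-cong (eq a n) (pairProduct-progression k h row eq (k ℕ.+ a) n)

  -- The point ik contributes 1/(q⁻¹;q⁻¹) of length ik and 1/(q;q) of length (M - i)k. By the
  -- hypothesis M - i is the number of points still to come, so the second product runs through its
  -- indices backwards; the start `i` is general for the sake of the induction.
  nodes-progression : ∀ k M i n → i ℕ.+ n ≡ suc M →
    nodes (M ℕ.* k) (progression k (i ℕ.* k) n) ≈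
    ∏< n (λ j → 1/⟨ (j ℕ.+ i) ℕ.* k ⟩!⁻) * ∏< n (λ j → 1/⟨ j ℕ.* k ⟩!)
  nodes-progression k M i zero    eq = sym (*-identityˡ _)
  nodes-progression k M i (suc n) eq = begin
    (1/⟨ i ℕ.* k ⟩!⁻ * 1/⟨ M ℕ.* k ∸ i ℕ.* k ⟩!) * nodes (M ℕ.* k) (progression k (suc i ℕ.* k) n)
      ≈⟨ *-cong (*-congˡ (reflexive (≡.cong 1/⟨_⟩! M∸i)))
           (nodes-progression k M (suc i) n (≡.trans (≡.sym (ℕ.+-suc i n)) eq)) ⟩
    (1/⟨ i ℕ.* k ⟩!⁻ * 1/⟨ n ℕ.* k ⟩!) * (∏< n (λ j → 1/⟨ (j ℕ.+ suc i) ℕ.* k ⟩!⁻) * ∏< n (λ j → 1/⟨ j ℕ.* k ⟩!))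
      ≈⟨ interchange _ _ _ _ ⟩
    (1/⟨ i ℕ.* k ⟩!⁻ * ∏< n (λ j → 1/⟨ (j ℕ.+ suc i) ℕ.* k ⟩!⁻)) * (1/⟨ n ℕ.* k ⟩! * ∏< n (λ j → 1/⟨ j ℕ.* k ⟩!))
      ≈⟨ *-congʳ (trans (*-congˡ (∏<-cong n (λ j → reflexive (≡.cong (λ m → 1/⟨ m ℕ.* k ⟩!⁻) (ℕ.+-suc j i)))))
                        (sym (∏<-first n (λ j → 1/⟨ (j ℕ.+ i) ℕ.* k ⟩!⁻)))) ⟩
    ∏< (suc n) (λ j → 1/⟨ (j ℕ.+ i) ℕ.* k ⟩!⁻) * ∏< (suc n) (λ j → 1/⟨ j ℕ.* k ⟩!) ∎
    where
    M∸i : M ℕ.* k ∸ i ℕ.* k ≡ n ℕ.* k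
    M∸i = ≡.trans (≡.sym (ℕ.*-distribʳ-∸ k M i))
      (≡.cong (ℕ._* k) (≡.trans (≡.cong (_∸ i) (ℕ.suc-injective (≡.trans (≡.sym eq) (ℕ.+-suc i n)))) (ℕ.m+n∸m≡n i n)))

  -- Common to both weights: `G d` is the q-factorial of (d + 1)k for the first and of (d + 1)k - 1
  -- for the symmetric one, and `c⁻¹` divides by the starting value `G 0`.
  module _ (k : ℕ) (h : ℕ → ℕ → Carrier) (c⁻¹ c : Carrier) (c⁻¹*c≈1 : c⁻¹ * c ≈ 1#) (G : ℕ → Carrier)
    (G0 : G 0 ≈ c)
    (step : ∀ a d → ⟨ d ℕ.* k ⟩!⁻ * G d * h a (suc d ℕ.* k ℕ.+ a) ≈ ⟨ suc d ℕ.* k ⟩!⁻ * G (suc d)) where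

    row-value : ∀ a D → ∏ (Vec.toList (progression k (k ℕ.+ a) D)) (h a) ≈ ⟨ D ℕ.* k ⟩!⁻ * (c⁻¹ * G D)
    row-value a D = begin
      ρ                                        ≈⟨ *-identityˡ _ ⟨
      1# * ρ                                   ≈⟨ *-congʳ c⁻¹*c≈1 ⟨
      (c⁻¹ * c) * ρ                            ≈⟨ *-assoc _ _ _ ⟩
      c⁻¹ * (c * ρ)                            ≈⟨ *-congˡ (*-congʳ (trans (*-identityˡ _) G0)) ⟨
      c⁻¹ * (1# * G 0 * ρ)                     ≡⟨ ≡.cong (λ m → c⁻¹ * (1# * G 0 * ∏ (Vec.toList (progression k (m ℕ.+ a) D)) (h a))) (ℕ.+-identityʳ k) ⟨
      c⁻¹ * (1# * G 0 * ∏ (Vec.toList (progression k (1 ℕ.* k ℕ.+ a) D)) (h a))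
        ≈⟨ *-congˡ (∏-telescope k (λ d → ⟨ d ℕ.* k ⟩!⁻ * G d) (h a) a (step a) 0 D) ⟩
      c⁻¹ * (⟨ D ℕ.* k ⟩!⁻ * G D)              ≈⟨ x∙yz≈y∙xz _ _ _ ⟩
      ⟨ D ℕ.* k ⟩!⁻ * (c⁻¹ * G D)              ∎
      where ρ = ∏ (Vec.toList (progression k (k ℕ.+ a) D)) (h a)

    -- `⟨ j ℕ.* k ⟩!⁻` occurs once in the row with `j` further points and once, inverted, in the
    -- interpolation weights. After cancellation a q-binomial coefficient remains for each `j` in
    -- both applications.
    value-at-progression : ∀ M →
      nodes (M ℕ.* k) (progression k 0 (suc M)) * pairProduct h (Vec.toList (progression k 0 (suc M))) ≈
      ∏< (suc M) (λ j → G j * (c⁻¹ * 1/⟨ j ℕ.* k ⟩!))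
    value-at-progression M = begin
      nodes (M ℕ.* k) (progression k 0 1+M) * pairProduct h (Vec.toList (progression k 0 1+M))
        ≈⟨ *-cong (nodes-progression k M 0 1+M ≡.refl) (pairProduct-progression k h _ row-value 0 1+M) ⟩
      (∏< 1+M (λ j → 1/⟨ (j ℕ.+ 0) ℕ.* k ⟩!⁻) * ∏< 1+M (λ j → 1/⟨ j ℕ.* k ⟩!)) * ∏< 1+M (λ j → ⟨ j ℕ.* k ⟩!⁻ * (c⁻¹ * G j))
        ≈⟨ *-congʳ (∏<-* 1+M _ _) ⟨
      ∏< 1+M (λ j → (1/⟨ (j ℕ.+ 0) ℕ.* k ⟩!⁻ * 1/⟨ j ℕ.* k ⟩!)) * ∏< 1+M (λ j → ⟨ j ℕ.* k ⟩!⁻ * (c⁻¹ * G j))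
        ≈⟨ ∏<-* 1+M _ _ ⟨
      ∏< 1+M (λ j → (1/⟨ (j ℕ.+ 0) ℕ.* k ⟩!⁻ * 1/⟨ j ℕ.* k ⟩!) * (⟨ j ℕ.* k ⟩!⁻ * (c⁻¹ * G j)))
        ≈⟨ ∏<-cong 1+M cancel ⟩
      ∏< 1+M (λ j → G j * (c⁻¹ * 1/⟨ j ℕ.* k ⟩!)) ∎
      where
      1+M = suc M

      cancel : ∀ j → (1/⟨ (j ℕ.+ 0) ℕ.* k ⟩!⁻ * 1/⟨ j ℕ.* k ⟩!) * (⟨ j ℕ.* k ⟩!⁻ * (c⁻¹ * G j)) ≈
                     G j * (c⁻¹ * 1/⟨ j ℕ.* k ⟩!)
      cancel j = begin
        (1/⟨ (j ℕ.+ 0) ℕ.* k ⟩!⁻ * s) * (⟨ m ⟩!⁻ * (c⁻¹ * G j))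
          ≡⟨ ≡.cong (λ i → (1/⟨ i ℕ.* k ⟩!⁻ * s) * (⟨ m ⟩!⁻ * (c⁻¹ * G j))) (ℕ.+-identityʳ j) ⟩
        (1/⟨ m ⟩!⁻ * s) * (⟨ m ⟩!⁻ * (c⁻¹ * G j))
          ≈⟨ interchange _ _ _ _ ⟩
        (1/⟨ m ⟩!⁻ * ⟨ m ⟩!⁻) * (s * (c⁻¹ * G j))
          ≈⟨ *-congʳ (1/⟨⟩!⁻-inverse m) ⟩
        1# * (s * (c⁻¹ * G j))
          ≈⟨ *-identityˡ _ ⟩
        s * (c⁻¹ * G j)
          ≈⟨ x∙yz≈z∙yx _ _ _ ⟩
        G j * (c⁻¹ * s) ∎
        where
        m = j ℕ.* k
        s = 1/⟨ m ⟩!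

  -- Constant terms of the two weights

  -- The q-binomials of (j + 1)k over k and, for k ≥ 1, of (j + 1)k - 1 over k - 1, with inverses in
  -- place of division.
  weightTerm symmetricTerm : ℕ → ℕ → Carrier
  weightTerm    k j = ⟨ suc j ℕ.* k ⟩! * (1/⟨ k ⟩! * 1/⟨ j ℕ.* k ⟩!)
  symmetricTerm k j = ⟨ suc j ℕ.* k ∸ 1 ⟩! * (1/⟨ k ∸ 1 ⟩! * 1/⟨ j ℕ.* k ⟩!)

  ct-weight : ∀ M k → let open LaurentPolynomials rawRing (suc M) in
    ct (weight q k) ≈ ∏< (suc M) (weightTerm k)
  ct-weight M k = begin
    ct (weight q k)
      ≈⟨ ct-interpolation N (λ _ → ℕ.≤-refl) (supp-weight q k) ⟩
    Σgrid 1+M (λ v → nodes N v * eval v (weight q k))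
      ≈⟨ Σgrid-cong 1+M (λ v _ → *-congˡ {nodes N v} (eval-weight v k)) ⟩
    Σgrid 1+M (λ v → nodes N v * pairProduct (weightFactor k) (Vec.toList v))
      ≈⟨ Σgrid-single 1+M (λ v → nodes N v * pairProduct (weightFactor k) (Vec.toList v))
           (progression k 0 1+M) (progression-≤ k 0 1+M) (λ v v≤N → vanish v v≤N (ℕ.m≤n⇒m<n∨m≡n ℕ.z≤n)) ⟩
    nodes N (progression k 0 1+M) * pairProduct (weightFactor k) (Vec.toList (progression k 0 1+M))
      ≈⟨ value-at-progression k (weightFactor k) 1/⟨ k ⟩! ⟨ k ⟩! (1/⟨⟩!-inverse k)
           (λ d → ⟨ suc d ℕ.* k ⟩!) (reflexive (≡.cong ⟨_⟩! (ℕ.+-identityʳ k))) (weightFactor-step k) M ⟩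
    ∏< 1+M (weightTerm k) ∎
    where
    1+M = suc M
    N = M ℕ.* k
    open LaurentPolynomials rawRing 1+M
    open LaurentSupport R 1+M
    open GridSums R N

    constant-progression : ∀ {m} (v : Vec ℕ m) → VecAll.All (ℕ._≤ M ℕ.* 0) v → v ≡ progression 0 0 m
    constant-progression []      _           = ≡.refl
    constant-progression (a ∷ v) (a≤0 ∷ v≤0) =
      ≡.cong₂ _∷_ (ℕ.n≤0⇒n≡0 (≡.subst (a ℕ.≤_) (ℕ.*-zeroʳ M) a≤0)) (constant-progression v v≤0)

    vanish : ∀ v → Bounded v → 0 ℕ.< k ⊎ 0 ≡ k →
      v ≡ progression k 0 1+M ⊎ nodes N v * pairProduct (weightFactor k) (Vec.toList v) ≈ 0#
    vanish v v≤N (inj₁ 1≤k) with pairProduct-vanish (weightFactor-vanish k) (Vec.toList v)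
    ... | inj₁ v# = inj₁ (orderedApart⇒≡progression k 1≤k v v# (VecAll.toList⁺ v≤N))
    ... | inj₂ ≈0 = inj₂ (trans (*-congˡ ≈0) (zeroʳ _))
    -- No factor vanishes for `k = 0`, but then `N = 0` and the grid is a single point.
    vanish v v≤N (inj₂ ≡.refl) = inj₁ (constant-progression v v≤N)

  -- The bound on `k` makes the entries of the progression distinct; for `k = 0` it is constant and
  -- has one rearrangement instead of n!.
  ct-symmetricWeight : ∀ M k → 1 ℕ.≤ k → let open LaurentPolynomials rawRing (suc M) in
    ct (symmetricWeight q k) ≈ (suc M !) · ∏< (suc M) (symmetricTerm k)
  ct-symmetricWeight M k@(suc k-1) 1≤k = begin
    ct (symmetricWeight q k)
      ≈⟨ ct-interpolation N (λ _ → ℕ.≤-refl) (supp-symmetricWeight q k) ⟩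
    Σgrid 1+M (λ v → nodes N v * eval v (symmetricWeight q k))
      ≈⟨ Σgrid-cong 1+M (λ v _ → *-cong (nodes≈∏ v) (eval-symmetricWeight v k)) ⟩
    Σgrid 1+M F
      ≈⟨ Σgrid-permutations 1+M (Vec.toList (progression k 0 1+M)) (Vec.length-toList (progression k 0 1+M))
           (progression-unique k 1≤k 0 1+M) (VecAll.toList⁺ (progression-≤ k 0 1+M))
           (λ v v↭ → *-cong (∏-↭ _ v↭) (pairProduct-↭ (λ a b → *-comm _ _) v↭))
           vanish ⟩
    (1+M !) · F (progression k 0 1+M)
      ≈⟨ ×-congʳ (1+M !) (trans (*-congʳ (sym (nodes≈∏ (progression k 0 1+M))))
           (value-at-progression k (symmetricFactor k) 1/⟨ k-1 ⟩! ⟨ k-1 ⟩! (1/⟨⟩!-inverse k-1)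
             (λ d → ⟨ suc d ℕ.* k ∸ 1 ⟩!) (reflexive (≡.cong ⟨_⟩! (ℕ.+-identityʳ k-1)))
             (symmetricFactor-step k-1) M)) ⟩
    (1+M !) · ∏< 1+M (symmetricTerm k) ∎
    where
    1+M = suc M
    N = M ℕ.* k
    open LaurentPolynomials rawRing 1+M
    open LaurentSupport R 1+M
    open GridSums R N
    open PermutationSums R N

    -- The interpolation weights become a product over the list, so that rearrangement acts on the
    -- whole summand.
    F : Vec ℕ 1+M → Carrier
    F v = ∏ (Vec.toList v) (λ a → node a (N ∸ a)) * pairProduct (symmetricFactor k) (Vec.toList v)

    nodes≈∏ : ∀ {m} (v : Vec ℕ m) → nodes N v ≈ ∏ (Vec.toList v) (λ a → node a (N ∸ a))
    nodes≈∏ []      = refl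
    nodes≈∏ (a ∷ v) = *-congˡ (nodes≈∏ v)

    vanish : ∀ v → Bounded v → ¬ (Vec.toList v ↭ Vec.toList (progression k 0 1+M)) → F v ≈ 0#
    vanish v v≤N ¬↭ with pairProduct-vanish (symmetricFactor-vanish k) (Vec.toList v)
    ... | inj₁ v# = contradiction (apart⇒↭progression k v v# (VecAll.toList⁺ v≤N)) ¬↭
    ... | inj₂ ≈0 = trans (*-congˡ ≈0) (zeroʳ _)

  -- The ratio of the two evaluations

  qInteger-q^ : ∀ k m → qInteger (q ^ k) m * (1# - q ^ k) ≈ 1# - q ^ (m ℕ.* k)
  qInteger-q^ k m = trans (qInteger-geometric (q ^ k) m)
    (+-congˡ (-‿cong (trans (^-assocʳ q k m) (reflexive (≡.cong (q ^_) (ℕ.*-comm k m))))))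

  -- [j + 1] at t = qᵏ is (1 - q^((j + 1)k))/(1 - qᵏ): the numerator completes the q-factorial of (j
  -- + 1)k - 1, the denominator that of k - 1.
  qInteger*symmetricTerm : ∀ k j → 1 ℕ.≤ k → qInteger (q ^ k) (suc j) * symmetricTerm k j ≈ weightTerm k j
  qInteger*symmetricTerm k@(suc k-1) j _ = begin
    [j+1] * (⟨ m ⟩! * (1/⟨ k-1 ⟩! * s))
      ≈⟨ *-congʳ [j+1]≈ ⟩
    ((1# - q ^ suc m) * r) * (⟨ m ⟩! * (1/⟨ k-1 ⟩! * s))
      ≈⟨ interchange _ _ _ _ ⟩
    ((1# - q ^ suc m) * ⟨ m ⟩!) * (r * (1/⟨ k-1 ⟩! * s))
      ≈⟨ *-cong (*-comm _ _) (x∙yz≈yx∙z _ _ _) ⟩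
    ⟨ suc m ⟩! * (1/⟨ k ⟩! * s) ∎
    where
    m = k-1 ℕ.+ j ℕ.* k
    r = 1/[1-q^1+ k-1 ]
    s = 1/⟨ j ℕ.* k ⟩!
    [j+1] = qInteger (q ^ k) (suc j)

    [j+1]≈ : [j+1] ≈ (1# - q ^ suc m) * r
    [j+1]≈ = begin
      [j+1]                               ≈⟨ *-identityʳ _ ⟨
      [j+1] * 1#                          ≈⟨ *-congˡ (1/[1-q^1+]-inverse k-1) ⟨
      [j+1] * (r * (1# - q ^ k))          ≈⟨ x∙yz≈xz∙y _ _ _ ⟩
      ([j+1] * (1# - q ^ k)) * r          ≈⟨ *-congʳ (qInteger-q^ k (suc j)) ⟩
      (1# - q ^ suc m) * r                ∎

  W₀*symmetricTerms : ∀ n k → 1 ℕ.≤ k → W₀ n (q ^ k) * ∏< n (symmetricTerm k) ≈ ∏< n (weightTerm k)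
  W₀*symmetricTerms n k 1≤k = begin
    W₀ n (q ^ k) * ∏< n (symmetricTerm k)
      ≈⟨ *-congʳ (W₀≈∏qInteger n (q ^ k)) ⟩
    ∏< n (qInteger (q ^ k) ∘ suc) * ∏< n (symmetricTerm k)
      ≈⟨ ∏<-* n (qInteger (q ^ k) ∘ suc) (symmetricTerm k) ⟨
    ∏< n (λ j → qInteger (q ^ k) (suc j) * symmetricTerm k j)
      ≈⟨ ∏<-cong n (λ j → qInteger*symmetricTerm k j 1≤k) ⟩
    ∏< n (weightTerm k) ∎

  qInteger-1 : ∀ m → qInteger 1# m ≈ m · 1#
  qInteger-1 zero    = refl
  qInteger-1 (suc m) = +-congˡ (trans (*-identityˡ _) (qInteger-1 m))

  W₀-1 : ∀ n → W₀ n 1# ≈ (n !) · 1#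
  W₀-1 n = trans (W₀≈∏qInteger n 1#) (factorial n)
    where
    factorial : ∀ n → ∏< n (qInteger 1# ∘ suc) ≈ (n !) · 1#
    factorial zero    = sym (+-identityʳ 1#)
    factorial (suc n) = trans (*-cong (qInteger-1 (suc n)) (factorial n)) (sym (×1-homo-* (suc n) (n !)))

  weightTerm-0 : ∀ k → weightTerm k 0 ≈ 1#
  weightTerm-0 k = begin
    ⟨ k ℕ.+ 0 ⟩! * (1/⟨ k ⟩! * 1#)  ≈⟨ *-cong (reflexive (≡.cong ⟨_⟩! (ℕ.+-identityʳ k))) (*-identityʳ _) ⟩
    ⟨ k ⟩! * 1/⟨ k ⟩!               ≈⟨ *-comm _ _ ⟩
    1/⟨ k ⟩! * ⟨ k ⟩!               ≈⟨ 1/⟨⟩!-inverse k ⟩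
    1#                              ∎

  symmetricTerm-0 : ∀ k → symmetricTerm k 0 ≈ 1#
  symmetricTerm-0 k = begin
    ⟨ k ℕ.+ 0 ∸ 1 ⟩! * (1/⟨ k ∸ 1 ⟩! * 1#)  ≈⟨ *-cong (reflexive (≡.cong (λ m → ⟨ m ∸ 1 ⟩!) (ℕ.+-identityʳ k))) (*-identityʳ _) ⟩
    ⟨ k ∸ 1 ⟩! * 1/⟨ k ∸ 1 ⟩!               ≈⟨ *-comm _ _ ⟩
    1/⟨ k ∸ 1 ⟩! * ⟨ k ∸ 1 ⟩!               ≈⟨ 1/⟨⟩!-inverse (k ∸ 1) ⟩
    1#                                      ∎

  ∏-[2⋯] : ∀ M f (g : ℕ → Carrier) → f 0 ≈ 1# → (∀ j → g (2 ℕ.+ j) ≈ f (suc j)) →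
    ∏ [2⋯ suc M ] g ≈ ∏< (suc M) f
  ∏-[2⋯] M f g f0≈1 g≈f = begin
    ∏ [2⋯ suc M ] g             ≈⟨ ∏-map (2 ℕ.+_) (List.upTo M) g ⟩
    ∏ (List.upTo M) (g ∘ (2 ℕ.+_))  ≈⟨ ∏-cong (List.upTo M) g≈f ⟩
    ∏ (List.upTo M) (f ∘ suc)   ≈⟨ ∏-applyUpTo id M ⟩
    ∏< M (f ∘ suc)              ≈⟨ *-identityˡ _ ⟨
    1# * ∏< M (f ∘ suc)         ≈⟨ *-congʳ f0≈1 ⟨
    f 0 * ∏< M (f ∘ suc)        ≈⟨ ∏<-first M f ⟨
    ∏< (suc M) f                ∎
    where
    ∏-applyUpTo : ∀ {h : ℕ → Carrier} u m → ∏ (List.applyUpTo u m) h ≈ ∏< m (h ∘ u)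
    ∏-applyUpTo         u zero    = refl
    ∏-applyUpTo {h = h} u (suc m) =
      trans (*-congˡ (∏-applyUpTo (u ∘ suc) m)) (sym (∏<-first m (h ∘ u)))

-- The inner product of 1 with itself

module _ {c ℓ} (R : CommutativeRing c ℓ) (n : ℕ) where

  open CommutativeRing R
  open LaurentPolynomials rawRing n
  open RawRing laurentRing using () renaming (_*_ to _*ᴸ_; 1# to 1ᴸ)
  open SetoidReasoning setoid

  0ᵛ+ : ∀ d → Vec.zipWith ℤ._+_ (0ᵛ n) d ≡ d
  0ᵛ+ = Vec.zipWith-identityˡ ℤ.+-identityˡ

  coefficient-scale : ∀ a e f → coefficient e (((a , 0ᵛ n) ∷ []) *ᴸ f) ≈ a * coefficient e f
  coefficient-scale a e []            = sym (zeroʳ a)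
  coefficient-scale a e ((b , d) ∷ f) rewrite 0ᵛ+ d
    with does (Vec.≡-dec ℤ._≟_ d e)
  ... | true  = trans (+-congˡ (coefficient-scale a e f)) (sym (distribˡ _ _ _))
  ... | false = coefficient-scale a e f

  ct-1*bar1* : ∀ σ → σ 1# ≈ 1# → ∀ f → ct ((1ᴸ *ᴸ bar σ 1ᴸ) *ᴸ f) ≈ ct f
  ct-1*bar1* σ σ1≈1 f = begin
    ct ((1ᴸ *ᴸ bar σ 1ᴸ) *ᴸ f)
      ≡⟨ ≡.cong (λ d → ct (((1# * σ 1# , d) ∷ []) *ᴸ f))
           (≡.trans (0ᵛ+ _) (Vec.map-replicate ℤ.-_ (+ 0) n)) ⟩
    ct (((1# * σ 1# , 0ᵛ n) ∷ []) *ᴸ f)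
      ≈⟨ coefficient-scale (1# * σ 1#) (0ᵛ n) f ⟩
    1# * σ 1# * ct f
      ≈⟨ *-congʳ (trans (*-identityˡ _) σ1≈1) ⟩
    1# * ct f
      ≈⟨ *-identityˡ _ ⟩
    ct f ∎

-- Division in the coefficient field

module FieldLemmas {c ℓ₁ ℓ₂} (𝔽 : CoefficientField c ℓ₁ ℓ₂) where

  open CoefficientField 𝔽 hiding (commutativeRing)
  open HeytingProperties (HeytingField.heytingCommutativeRing heytingField)
  open Division 𝔽
  open QBinomial 𝔽
  open SetoidReasoning setoid

  inverseˡ : ∀ {x} (x#0 : x # 0#) → proj₁ (#⇒invertible x#0) * x ≈ 1#
  inverseˡ x#0 with y , y*[x-0]≈1 , _ ← #⇒invertible x#0 = trans (*-congˡ (sym (x-0≈x _))) y*[x-0]≈1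

  /-unique : ∀ {x y z} (y#0 : y # 0#) → y * z ≈ x → x / y ⟨ y#0 ⟩ ≈ z
  /-unique {x} {y} {z} y#0 yz≈x = begin
    x * y⁻¹        ≈⟨ *-comm _ _ ⟩
    y⁻¹ * x        ≈⟨ *-congˡ yz≈x ⟨
    y⁻¹ * (y * z)  ≈⟨ *-assoc _ _ _ ⟨
    y⁻¹ * y * z    ≈⟨ *-congʳ (inverseˡ y#0) ⟩
    1# * z         ≈⟨ *-identityˡ z ⟩
    z              ∎
    where y⁻¹ = proj₁ (#⇒invertible y#0)

  -- The two inverses come from different proofs of apartness; they agree because inverses are
  -- unique.
  /-cong : ∀ {x x′ y y′} (y#0 : y # 0#) (y′#0 : y′ # 0#) → x ≈ x′ → y ≈ y′ → x / y ⟨ y#0 ⟩ ≈ x′ / y′ ⟨ y′#0 ⟩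
  /-cong {x} {x′} {y} {y′} y#0 y′#0 x≈x′ y≈y′ = /-unique y#0 (begin
    y * (x′ * y′⁻¹)    ≈⟨ *-congʳ y≈y′ ⟩
    y′ * (x′ * y′⁻¹)   ≈⟨ *-comm _ _ ⟩
    x′ * y′⁻¹ * y′     ≈⟨ *-assoc _ _ _ ⟩
    x′ * (y′⁻¹ * y′)   ≈⟨ *-congˡ (inverseˡ y′#0) ⟩
    x′ * 1#            ≈⟨ *-identityʳ _ ⟩
    x′                 ≈⟨ x≈x′ ⟨
    x                  ∎)
    where y′⁻¹ = proj₁ (#⇒invertible y′#0)

  invertible⇒#0 : ∀ {x} y → y * x ≈ 1# → x # 0#
  invertible⇒#0 y yx≈1 = invertibleˡ⇒# (y , trans (*-congˡ (x-0≈x _)) yx≈1)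

  qParameter : QParameter (CoefficientField.commutativeRing 𝔽)
  qParameter = record
    { q                  = q
    ; q⁻¹                = conj q
    ; q⁻¹*q≈1            = conj-q
    ; 1/[1-q^1+_]        = λ m → proj₁ (#⇒invertible (1-qʳ⁺¹#0 m))
    ; 1/[1-q^1+]-inverse = λ m →
        trans (*-congˡ (+-congˡ (-‿cong (*-comm q (q ^ m))))) (inverseˡ (1-qʳ⁺¹#0 m))
    }

proposition7p6 : ∀ {c ℓ₁ ℓ₂} (𝔽 : CoefficientField c ℓ₁ ℓ₂) →
    let open CoefficientField 𝔽
        open RingOperations rawRing
        open Division 𝔽
        open InnerProduct 𝔽
        open QBinomial 𝔽
    in
    ∀ (n k : ℕ) → 1 ℕ.≤ n →
    let open LaurentPolynomials rawRing n
        1ᴸ = RawRing.1# laurentRing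
    in
    ( innerProduct k 1ᴸ 1ᴸ ≈ ct (weight q k)
    × ct (weight q k) ≈ ∏ [2⋯ n ] (λ i → qBinomial (i ℕ.* k) k) )
    ×
    ( Σ[ W₀#0 ∈ W₀ n (q ^ k) # 0# ]
        innerProduct k 1ᴸ 1ᴸ / W₀ n (q ^ k) ⟨ W₀#0 ⟩
          ≈ ct (symmetricWeight q k) / (n !) · 1# ⟨ n!#0 𝔽 n ⟩ )
    ×
    ( n ≡ 1 ⊎ 1 ℕ.≤ k →
        ct (symmetricWeight q k) / (n !) · 1# ⟨ n!#0 𝔽 n ⟩
          ≈ ∏ [2⋯ n ] (λ h → qBinomial (h ℕ.* k ∸ 1) (k ∸ 1)) )
proposition7p6 𝔽 n@(suc M) k _ =
  (innerProduct≈ct k , trans (ct-weight M k) (sym weight-qBinomials)) ,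
  (W₀#0 k , quotients k) ,
  -- For `k = 0` and n ≥ 2 the left side is 1/n!, while truncated subtraction turns every q-binomial
  -- on the right into 1; hence the condition.
  λ n≡1⊎1≤k → trans (ct/n! k n≡1⊎1≤k) (sym symmetric-qBinomials)
  where
  open CoefficientField 𝔽 hiding (commutativeRing)
  open HeytingProperties (HeytingField.heytingCommutativeRing heytingField)
  open RingMorphisms rawRing rawRing using (module IsRingHomomorphism)
  open RingOperations rawRing
  open Division 𝔽
  open InnerProduct 𝔽 {n}
  open QBinomial 𝔽
  open LaurentPolynomials rawRing n
  open FieldLemmas 𝔽

  R : CommutativeRing _ _
  R = CoefficientField.commutativeRing 𝔽

  open CommutativeRing R using (semiring)
  open ListSums R
  open Mult semiring using (×-congʳ; ×-assoc-*)
  open QParameter qParameter using (1/[1-q^1+_]; 1/[1-q^1+]-inverse)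
  open ConstantTerms qParameter
  open SetoidReasoning setoid

  1ᴸ : Laurent
  1ᴸ = RawRing.1# laurentRing

  innerProduct≈ct : ∀ k → innerProduct k 1ᴸ 1ᴸ ≈ ct (weight q k)
  innerProduct≈ct k = ct-1*bar1* R n conj (IsRingHomomorphism.1#-homo conj-homomorphism) (weight q k)

  qBinomial≈ : ∀ a b d → a ∸ b ≡ d → qBinomial a b ≈ ⟨ a ⟩! * (1/⟨ b ⟩! * 1/⟨ d ⟩!)
  qBinomial≈ a b d ≡.refl = /-unique _ (begin
    pochhammer q q b * pochhammer q q d * (⟨ a ⟩! * (1/⟨ b ⟩! * 1/⟨ d ⟩!))
      ≈⟨ *-cong (*-cong (pochhammer-q≈⟨⟩! b) (pochhammer-q≈⟨⟩! d)) refl ⟩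
    ⟨ b ⟩! * ⟨ d ⟩! * (⟨ a ⟩! * (1/⟨ b ⟩! * 1/⟨ d ⟩!))
      ≈⟨ x∙yz≈y∙zx _ _ _ ⟩
    ⟨ a ⟩! * ((1/⟨ b ⟩! * 1/⟨ d ⟩!) * (⟨ b ⟩! * ⟨ d ⟩!))
      ≈⟨ *-congˡ (trans (interchange _ _ _ _) (trans (*-cong (1/⟨⟩!-inverse b) (1/⟨⟩!-inverse d)) (*-identityˡ _))) ⟩
    ⟨ a ⟩! * 1#
      ≈⟨ *-identityʳ _ ⟩
    ⟨ a ⟩!
      ≈⟨ pochhammer-q≈⟨⟩! a ⟨
    pochhammer q q a ∎)
    where
    open CommutativeSemigroupProperties (CommutativeRing.*-commutativeSemigroup R)

  weight-qBinomials : ∏ [2⋯ n ] (λ i → qBinomial (i ℕ.* k) k) ≈ ∏< n (weightTerm k)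
  weight-qBinomials = ∏-[2⋯] M (weightTerm k) _ (weightTerm-0 k)
    λ j → qBinomial≈ _ k (suc j ℕ.* k) (ℕ.m+n∸m≡n k _)

  symmetric-qBinomials : ∏ [2⋯ n ] (λ h → qBinomial (h ℕ.* k ∸ 1) (k ∸ 1)) ≈ ∏< n (symmetricTerm k)
  symmetric-qBinomials = ∏-[2⋯] M (symmetricTerm k) _ (symmetricTerm-0 k)
    λ j → qBinomial≈ _ (k ∸ 1) (suc j ℕ.* k) (difference k j)
    where
    difference : ∀ k j → (k ℕ.+ suc j ℕ.* k) ∸ 1 ∸ (k ∸ 1) ≡ suc j ℕ.* k
    difference zero      j = ≡.trans (≡.cong (_∸ 1) (ℕ.*-zeroʳ j)) (≡.sym (ℕ.*-zeroʳ j))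
    difference (suc k-1) j = ℕ.m+n∸m≡n k-1 _

  ∏<-#0 : ∀ m f → (∀ j → f j # 0#) → ∏< m f # 0#
  ∏<-#0 zero    f f#0 = 1#0
  ∏<-#0 (suc m) f f#0 = x#0y#0→xy#0 (f#0 m) (∏<-#0 m f f#0)

  W₀#0 : ∀ k → W₀ n (q ^ k) # 0#
  -- At `q ^ 0` the value is n!, and characteristic 0 keeps it apart from 0; for k ≥ 1 it is the
  -- invertibility of the 1 - qᵐ that does so.
  W₀#0 zero      = #-congʳ (sym (W₀-1 n)) (n!#0 𝔽 n)
  W₀#0 k@(suc _) = #-congʳ (sym (W₀≈∏qInteger n (q ^ k))) (∏<-#0 n _ qInteger#0)
    where
    qInteger#0 : ∀ j → qInteger (q ^ k) (suc j) # 0#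
    -- The inverse is (1 - qᵏ)/(1 - q^((j + 1)k)). The reciprocals are indexed from exponent 1, so
    -- `m` is one less than (j + 1)k.
    qInteger#0 j = invertible⇒#0 (1/[1-q^1+ m ] * (1# - q ^ k)) (begin
      1/[1-q^1+ m ] * (1# - q ^ k) * qInteger (q ^ k) (suc j)    ≈⟨ *-assoc _ _ _ ⟩
      1/[1-q^1+ m ] * ((1# - q ^ k) * qInteger (q ^ k) (suc j))  ≈⟨ *-congˡ (trans (*-comm _ _) (qInteger-q^ k (suc j))) ⟩
      1/[1-q^1+ m ] * (1# - q ^ suc m)                           ≈⟨ 1/[1-q^1+]-inverse m ⟩
      1#                                                         ∎)
      where m = ℕ.pred (suc j ℕ.* k)

  ct/n!≈symmetricTerms : ∀ k → 1 ℕ.≤ k →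
    ct (symmetricWeight q k) / (n !) · 1# ⟨ n!#0 𝔽 n ⟩ ≈ ∏< n (symmetricTerm k)
  ct/n!≈symmetricTerms k 1≤k = /-unique (n!#0 𝔽 n) (begin
    (n !) · 1# * ∏< n (symmetricTerm k)    ≈⟨ ×-assoc-* (n !) 1# _ ⟩
    (n !) · (1# * ∏< n (symmetricTerm k))  ≈⟨ ×-congʳ (n !) (*-identityˡ _) ⟩
    (n !) · ∏< n (symmetricTerm k)         ≈⟨ ct-symmetricWeight M k 1≤k ⟨
    ct (symmetricWeight q k)               ∎)

  quotients : ∀ k → innerProduct k 1ᴸ 1ᴸ / W₀ n (q ^ k) ⟨ W₀#0 k ⟩ ≈
                    ct (symmetricWeight q k) / (n !) · 1# ⟨ n!#0 𝔽 n ⟩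
  -- At `k = 0` the two weights are the same expression, and W₀(1) = n!.
  quotients zero      = /-cong (W₀#0 0) (n!#0 𝔽 n) (innerProduct≈ct 0) (W₀-1 n)
  quotients k@(suc _) = trans (/-unique (W₀#0 k) (begin
    W₀ n (q ^ k) * ∏< n (symmetricTerm k)  ≈⟨ W₀*symmetricTerms n k (ℕ.s≤s ℕ.z≤n) ⟩
    ∏< n (weightTerm k)                    ≈⟨ ct-weight M k ⟨
    ct (weight q k)                        ≈⟨ innerProduct≈ct k ⟨
    innerProduct k 1ᴸ 1ᴸ                   ∎)) (sym (ct/n!≈symmetricTerms k (ℕ.s≤s ℕ.z≤n)))

  ct/n! : ∀ k → n ≡ 1 ⊎ 1 ℕ.≤ k →
    ct (symmetricWeight q k) / (n !) · 1# ⟨ n!#0 𝔽 n ⟩ ≈ ∏< n (symmetricTerm k)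
  ct/n! k         (inj₂ 1≤k) = ct/n!≈symmetricTerms k 1≤k
  ct/n! k@(suc _) (inj₁ _)   = ct/n!≈symmetricTerms k (ℕ.s≤s ℕ.z≤n)
  -- At `k = 0` all factorials in both terms reduce to `⟨ 0 ⟩!`, so the symmetric evaluation is the
  -- one already known for the first weight; n! = 1 removes the normalisation.
  ct/n! zero      (inj₁ n≡1) = /-unique (n!#0 𝔽 n) (begin
    (n !) · 1# * ∏< n (symmetricTerm 0)
      ≈⟨ *-congʳ (trans (reflexive (≡.cong (λ m → (m !) · 1#) n≡1)) (+-identityʳ 1#)) ⟩
    1# * ∏< n (symmetricTerm 0)
      ≈⟨ *-identityˡ _ ⟩
    ∏< n (symmetricTerm 0)
      ≈⟨ ∏<-cong n (λ j → reflexive (≡.cong (λ m → ⟨ m ⟩! * (1# * 1/⟨ j ℕ.* 0 ⟩!))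
           (≡.trans (≡.cong (_∸ 1) (ℕ.*-zeroʳ j)) (≡.sym (ℕ.*-zeroʳ j))))) ⟩
    ∏< n (weightTerm 0)
      ≈⟨ ct-weight M 0 ⟨
    ct (symmetricWeight q 0) ∎)
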